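{- There exist an absolute constant $c>0$ and an integer $n_0$ such that for every integer $n\ge n_0$, every positive integer $k$ with $k\le \exp\!\left(c\frac{n}{\log n}\right)$ belongs to $\mathrm{LE}(n)$; that is, for each such $k$ there is a poset $P$ with exactly $n$ elements and $\mathrm{ext}(P)=k$.
   Context: All posets are finite. For a finite poset $P$, $\mathrm{ext}(P)$ denotes the number of linear extensions of $P$ (total orders on the ground set of $P$ that extend the partial order). For a positive integer $n$, $\mathrm{LE}(n)=\{\mathrm{ext}(P): P \text{ a poset with } |P|=n\}$. Logarithms are natural. -}

module Defs where

open import Data.Fin.Base using (Fin)
open import Data.Integer.Base as ℤ using (+_; +[1+_])
import Data.Integer.Properties as ℤP
open import Data.Nat.Base as ℕ using (ℕ; zero; suc)
import Data.Nat.Properties as ℕP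
open import Data.Product.Base using (Σ; _×_; _,_; proj₁; proj₂; ∃-syntax)
open import Data.Rational.Base using (ℚ; mkℚ; 0ℚ; 1ℚ; ½; _+_; _-_; _*_; -_; _/_; 1/_; ∣_∣; _≤_; _<_; toℚᵘ; NonZero; Positive; positive; nonNegative; ≢-nonZero)
open import Data.Rational.Properties as ℚP using (_≟_; _≤?_)
import Data.Rational.Unnormalised.Base as ℚᵘ
import Data.Rational.Unnormalised.Properties as ℚᵘP
open import Data.Rational.Solver using (module +-*-Solver)
open import Data.Sum.Base using (_⊎_; inj₁; inj₂)
open import Function.Bundles using (Inverse; _⇔_)
open import Function.Construct.Composition using (_⇔-∘_)
open import Function.Construct.Identity using (⇔-id)
open import Function.Construct.Symmetry using (⇔-sym)
open import Level using (0ℓ)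
open import Relation.Binary.Bundles using (Setoid)
open import Relation.Binary.Core using (Rel; _⇒_)
open import Relation.Binary.PropositionalEquality using (_≡_; _≢_; refl; sym; trans; cong; cong₂; subst; subst₂)
open import Relation.Binary.PropositionalEquality.Properties using (setoid)
open import Relation.Binary.Structures using (IsDecPartialOrder; IsTotalOrder)
open import Relation.Nullary using (¬_; Dec; yes; no; contradiction)
open import Relation.Unary using (Pred)

open ℚP.≤-Reasoning
open +-*-Solver using (solve; _:=_; _:+_; _:*_; _:-_; :-_; con)

ι : ℕ → ℚ
ι n = + n / 1

inv : ℕ → ℚ
inv m = + 1 / suc m

toℚᵘ-/ : ∀ i d → toℚᵘ (i / suc d) ℚᵘ.≃ ℚᵘ.mkℚᵘ i d
toℚᵘ-/ i d = ℚP.toℚᵘ-fromℚᵘ (ℚᵘ.mkℚᵘ i d)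

fromᵘ : ∀ {p q p′ q′} → toℚᵘ p ℚᵘ.≃ p′ → toℚᵘ q ℚᵘ.≃ q′ → p′ ℚᵘ.≃ q′ → p ≡ q
fromᵘ e f g = ℚP.toℚᵘ-injective (ℚᵘP.≃-trans e (ℚᵘP.≃-trans g (ℚᵘP.≃-sym f)))

ι-+ : ∀ m n → ι (m ℕ.+ n) ≡ ι m + ι n
ι-+ m n = fromᵘ (toℚᵘ-/ (+ (m ℕ.+ n)) 0)
  (ℚᵘP.≃-trans (ℚP.toℚᵘ-homo-+ (ι m) (ι n)) (ℚᵘP.+-cong (toℚᵘ-/ (+ m) 0) (toℚᵘ-/ (+ n) 0)))
  (ℚᵘ.*≡* (cong (ℤ._* + 1) (sym (cong₂ ℤ._+_ (ℤP.*-identityʳ (+ m)) (ℤP.*-identityʳ (+ n))))))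

ι-* : ∀ m n → ι (m ℕ.* n) ≡ ι m * ι n
ι-* m n = fromᵘ (toℚᵘ-/ (+ (m ℕ.* n)) 0)
  (ℚᵘP.≃-trans (ℚP.toℚᵘ-homo-* (ι m) (ι n)) (ℚᵘP.*-cong (toℚᵘ-/ (+ m) 0) (toℚᵘ-/ (+ n) 0)))
  (ℚᵘ.*≡* (cong (ℤ._* + 1) (ℤP.pos-* m n)))

ι*inv : ∀ m → ι (suc m) * inv m ≡ 1ℚ
ι*inv m = fromᵘ
  (ℚᵘP.≃-trans (ℚP.toℚᵘ-homo-* (ι (suc m)) (inv m)) (ℚᵘP.*-cong (toℚᵘ-/ (+ suc m) 0) (toℚᵘ-/ (+ 1) m)))
  ℚᵘP.≃-refl
  (ℚᵘ.*≡* (trans (ℤP.*-identityʳ _) (trans (ℤP.*-identityʳ _)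
     (sym (trans (ℤP.*-identityˡ _) (cong (λ z → + suc z) (ℕP.+-identityʳ m)))))))

inv>0 : ∀ m → 0ℚ < inv m
inv>0 m = ℚP.positive⁻¹ (inv m) {{ℚP.normalize-pos 1 (suc m)}}

inv≥0 : ∀ m → 0ℚ ≤ inv m
inv≥0 m = ℚP.<⇒≤ (inv>0 m)

ι≥0 : ∀ n → 0ℚ ≤ ι n
ι≥0 n = ℚP.nonNegative⁻¹ (ι n) {{ℚP.normalize-nonNeg n 1}}

inv-anti : ∀ {m n} → m ℕ.≤ n → inv n ≤ inv m
inv-anti {m} {n} m≤n = ℚP.toℚᵘ-cancel-≤
  (ℚᵘP.≤-respˡ-≃ (ℚᵘP.≃-sym (toℚᵘ-/ (+ 1) n)) (ℚᵘP.≤-respʳ-≃ (ℚᵘP.≃-sym (toℚᵘ-/ (+ 1) m))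
    (ℚᵘ.*≤* (subst₂ ℤ._≤_ (sym (ℤP.*-identityˡ _)) (sym (ℤP.*-identityˡ _)) (ℤ.+≤+ (ℕ.s≤s m≤n))))))

*-≥0 : ∀ {p q} → 0ℚ ≤ p → 0ℚ ≤ q → 0ℚ ≤ p * q
*-≥0 {p} {q} h k = ℚP.nonNegative⁻¹ (p * q)
  {{ℚP.nonNeg*nonNeg⇒nonNeg p {{nonNegative h}} q {{nonNegative k}}}}

*->0 : ∀ {p q} → 0ℚ < p → 0ℚ < q → 0ℚ < p * q
*->0 {p} {q} h k = ℚP.positive⁻¹ (p * q) {{ℚP.pos*pos⇒pos p {{positive h}} q {{positive k}}}}

*-monoʳ : ∀ {p q} r → 0ℚ ≤ r → p ≤ q → p * r ≤ q * r
*-monoʳ r h = ℚP.*-monoʳ-≤-nonNeg r {{nonNegative h}}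

*-monoˡ : ∀ {p q} r → 0ℚ ≤ r → p ≤ q → r * p ≤ r * q
*-monoˡ r h = ℚP.*-monoˡ-≤-nonNeg r {{nonNegative h}}

*-mono : ∀ {p q r s} → 0ℚ ≤ q → 0ℚ ≤ r → p ≤ q → r ≤ s → p * r ≤ q * s
*-mono {q = q} {r = r} q≥0 r≥0 h k = ℚP.≤-trans (*-monoʳ r r≥0 h) (*-monoˡ q q≥0 k)

+-≥0 : ∀ {p q} → 0ℚ ≤ p → 0ℚ ≤ q → 0ℚ ≤ p + q
+-≥0 = ℚP.+-mono-≤

≤+ : ∀ p {q} → 0ℚ ≤ q → p ≤ p + q
≤+ p {q} h = subst (_≤ p + q) (ℚP.+-identityʳ p) (ℚP.+-monoʳ-≤ p h)

-≥0 : ∀ {p q} → p ≤ q → 0ℚ ≤ q - p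
-≥0 {p} {q} h = subst (_≤ q - p) (ℚP.+-inverseʳ p) (ℚP.+-monoˡ-≤ (- p) h)

≤+⇒-≤ : ∀ {p q r} → p ≤ q + r → p - q ≤ r
≤+⇒-≤ {p} {q} {r} h = subst (p - q ≤_)
  (solve 2 (λ q r → q :+ r :- q := r) refl q r) (ℚP.+-monoˡ-≤ (- q) h)

∣-∣-sym : ∀ p q → ∣ p - q ∣ ≡ ∣ q - p ∣
∣-∣-sym p q = trans (sym (ℚP.∣-p∣≡∣p∣ (p - q)))
  (cong ∣_∣ (solve 2 (λ p q → :- (p :- q) := q :- p) refl p q))

∣-∣-tri : ∀ p q r → ∣ p - r ∣ ≤ ∣ p - q ∣ + ∣ q - r ∣
∣-∣-tri p q r = subst (λ z → ∣ z ∣ ≤ ∣ p - q ∣ + ∣ q - r ∣)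
  (solve 3 (λ p q r → (p :- q) :+ (q :- r) := p :- r) refl p q r) (ℚP.∣p+q∣≤∣p∣+∣q∣ (p - q) (q - r))

∣-∣-≥ : ∀ {p q} → p ≤ q → ∣ q - p ∣ ≡ q - p
∣-∣-≥ h = ℚP.0≤p⇒∣p∣≡p (-≥0 h)

∣-∣-≤ : ∀ {p q} → p ≤ q → ∣ p - q ∣ ≡ q - p
∣-∣-≤ {p} {q} h = trans (∣-∣-sym p q) (∣-∣-≥ h)

p≤∣p∣ : ∀ p → p ≤ ∣ p ∣
p≤∣p∣ p with ℚP.≤-total 0ℚ p
... | inj₁ h = ℚP.≤-reflexive (sym (ℚP.0≤p⇒∣p∣≡p h))
... | inj₂ h = ℚP.≤-trans h (ℚP.0≤∣p∣ p)

½+½ : ∀ p → ½ * p + ½ * p ≡ p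
½+½ p = trans (sym (ℚP.*-distribʳ-+ p ½ ½)) (ℚP.*-identityˡ p)

½≥0 : 0ℚ ≤ ½
½≥0 = ℚP.nonNegative⁻¹ ½

½>0 : 0ℚ < ½
½>0 = ℚP.positive⁻¹ ½

1≥0 : 0ℚ ≤ 1ℚ
1≥0 = ℚP.nonNegative⁻¹ 1ℚ

shrink : ∀ {C ε} → 0ℚ ≤ C → 0ℚ < ε → ∃[ δ ] 0ℚ < δ × C * δ ≤ ε
shrink {C} {ε} C≥0 ε>0 = ε * d , *->0 ε>0 d>0 , (begin
    C * (ε * d)         ≤⟨ *-monoʳ (ε * d) (ℚP.<⇒≤ (*->0 ε>0 d>0)) (≤+ C 1≥0) ⟩
    (C + 1ℚ) * (ε * d)  ≡⟨ solve 3 (λ c e d → c :* (e :* d) := e :* (c :* d)) refl (C + 1ℚ) ε d ⟩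
    ε * ((C + 1ℚ) * d)  ≡⟨ cong (ε *_) (ℚP.*-inverseʳ (C + 1ℚ) {{nz}}) ⟩
    ε * 1ℚ              ≡⟨ ℚP.*-identityʳ ε ⟩
    ε                   ∎)
  where
  C+1>0 : 0ℚ < C + 1ℚ
  C+1>0 = ℚP.+-mono-≤-< C≥0 (ℚP.positive⁻¹ 1ℚ)
  nz : NonZero (C + 1ℚ)
  nz = ℚP.pos⇒nonZero (C + 1ℚ) {{positive C+1>0}}
  d : ℚ
  d = (1/ (C + 1ℚ)) {{nz}}
  d>0 : 0ℚ < d
  d>0 = ℚP.positive⁻¹ d {{ℚP.1/pos⇒pos (C + 1ℚ) {{positive C+1>0}}}}

archimedean⁺ : ∀ ε → {{Positive ε}} → ∃[ N ] inv N ≤ ε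
archimedean⁺ (mkℚ +[1+ a ] d _) = d , ℚP.toℚᵘ-cancel-≤
  (ℚᵘP.≤-respˡ-≃ (ℚᵘP.≃-sym (toℚᵘ-/ (+ 1) d))
    (ℚᵘ.*≤* (ℤP.*-monoʳ-≤-nonNeg (+ suc d) (ℤ.+≤+ (ℕ.s≤s (ℕ.z≤n {a}))))))

archimedean : ∀ {ε} → 0ℚ < ε → ∃[ N ] inv N ≤ ε
archimedean {ε} h = archimedean⁺ ε {{positive h}}

Eventually : (ℕ → Set) → Set
Eventually P = ∃[ N ] ∀ m → N ℕ.≤ m → P m

C*inv-null : ∀ {C ε} → 0ℚ ≤ C → 0ℚ < ε → Eventually λ m → C * inv m ≤ ε
C*inv-null {C} C≥0 ε>0 =
  let δ , δ>0 , Cδ≤ε = shrink C≥0 ε>0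
      N , h = archimedean δ>0
  in N , λ m N≤m → ℚP.≤-trans (*-monoˡ C C≥0 (ℚP.≤-trans (inv-anti N≤m) h)) Cδ≤ε

-- term i x = xⁱ / i!
term : ℕ → ℚ → ℚ
term zero    x = 1ℚ
term (suc i) x = term i x * (x * inv i)

-- expSum m x = Σ_{i ≤ m} xⁱ / i!
expSum : ℕ → ℚ → ℚ
expSum zero    x = term zero x
expSum (suc m) x = expSum m x + term (suc m) x

decr : ∀ (f : ℕ → ℚ) K → (∀ m → K ℕ.≤ m → f (suc m) ≤ f m) →
       ∀ {m n} → K ℕ.≤ m → m ℕ.≤′ n → f n ≤ f m
decr f K h K≤m (ℕ.≤′-reflexive refl) = ℚP.≤-refl
decr f K h K≤m (ℕ.≤′-step m≤n) =
  ℚP.≤-trans (h _ (ℕP.≤-trans K≤m (ℕP.≤′⇒≤ m≤n))) (decr f K h K≤m m≤n)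

term≥0 : ∀ i {x} → 0ℚ ≤ x → 0ℚ ≤ term i x
term≥0 zero    h = 1≥0
term≥0 (suc i) h = *-≥0 (term≥0 i h) (*-≥0 h (inv≥0 i))

expSum≥0 : ∀ m {x} → 0ℚ ≤ x → 0ℚ ≤ expSum m x
expSum≥0 zero    h = 1≥0
expSum≥0 (suc m) h = +-≥0 (expSum≥0 m h) (term≥0 (suc m) h)

term-mono : ∀ i {x y} → 0ℚ ≤ x → x ≤ y → term i x ≤ term i y
term-mono zero    h k = ℚP.≤-refl
term-mono (suc i) h k = *-mono (term≥0 i (ℚP.≤-trans h k)) (*-≥0 h (inv≥0 i))
  (term-mono i h k) (*-monoʳ (inv i) (inv≥0 i) k)

∣term∣ : ∀ i x → ∣ term i x ∣ ≡ term i ∣ x ∣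
∣term∣ zero    x = refl
∣term∣ (suc i) x = trans (ℚP.∣p*q∣≡∣p∣*∣q∣ (term i x) (x * inv i))
  (cong₂ _*_ (∣term∣ i x) (trans (ℚP.∣p*q∣≡∣p∣*∣q∣ x (inv i)) (cong (∣ x ∣ *_) (ℚP.0≤p⇒∣p∣≡p (inv≥0 i)))))

expSum-expands : ∀ m {a b} → 0ℚ ≤ a → a ≤ b → b - a ≤ expSum (suc m) b - expSum (suc m) a
expSum-expands zero {a} {b} h k = ℚP.≤-reflexive
  (solve 2 (λ a b → b :- a := (con 1ℚ :+ con 1ℚ :* (b :* con 1ℚ)) :- (con 1ℚ :+ con 1ℚ :* (a :* con 1ℚ))) refl a b)
expSum-expands (suc m) {a} {b} h k = begin
  b - a                          ≤⟨ expSum-expands m h k ⟩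
  eb - ea                        ≤⟨ ≤+ (eb - ea) (-≥0 (term-mono (2 ℕ.+ m) h k)) ⟩
  (eb - ea) + (tb - ta)          ≡⟨ solve 4 (λ p q r s → (p :- q) :+ (r :- s) := (p :+ r) :- (q :+ s)) refl eb ea tb ta ⟩
  (eb + tb) - (ea + ta)          ∎
  where
  ea eb ta tb : ℚ
  ea = expSum (suc m) a
  eb = expSum (suc m) b
  ta = term (2 ℕ.+ m) a
  tb = term (2 ℕ.+ m) b

expSum-mono : ∀ m {a b} → 0ℚ ≤ a → a ≤ b → expSum m a ≤ expSum m b
expSum-mono zero    h k = ℚP.≤-refl
expSum-mono (suc m) h k = ℚP.+-mono-≤ (expSum-mono m h k) (term-mono (suc m) h k)

expSum-expands-∣∣ : ∀ m {a b} → 0ℚ ≤ a → 0ℚ ≤ b → ∣ a - b ∣ ≤ ∣ expSum (suc m) a - expSum (suc m) b ∣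
expSum-expands-∣∣ m {a} {b} a≥0 b≥0 = go (ℚP.≤-total a b)
  where
  go : a ≤ b ⊎ b ≤ a → ∣ a - b ∣ ≤ ∣ expSum (suc m) a - expSum (suc m) b ∣
  go (inj₁ h) = subst₂ _≤_ (sym (∣-∣-≤ h)) (sym (∣-∣-≤ (expSum-mono (suc m) a≥0 h))) (expSum-expands m a≥0 h)
  go (inj₂ h) = subst₂ _≤_ (sym (∣-∣-≥ h)) (sym (∣-∣-≥ (expSum-mono (suc m) b≥0 h))) (expSum-expands m b≥0 h)

module OnBall (B : ℚ) (B≥0 : 0ℚ ≤ B) where

  ∣term∣≤ : ∀ i {x} → ∣ x ∣ ≤ B → ∣ term i x ∣ ≤ term i B
  ∣term∣≤ i {x} h = subst (_≤ term i B) (sym (∣term∣ i x)) (term-mono i (ℚP.0≤∣p∣ x) h)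

  term-lip : ∀ i {x y} → ∣ x ∣ ≤ B → ∣ y ∣ ≤ B → ∣ term (suc i) x - term (suc i) y ∣ ≤ ∣ x - y ∣ * term i B
  term-lip zero {x} {y} h k = ℚP.≤-reflexive (trans
    (cong ∣_∣ (solve 2 (λ x y → con 1ℚ :* (x :* con 1ℚ) :- con 1ℚ :* (y :* con 1ℚ) := x :- y) refl x y))
    (sym (ℚP.*-identityʳ ∣ x - y ∣)))
  term-lip (suc j) {x} {y} h k = begin
    ∣ tx * (x * w) - ty * (y * w) ∣
      ≡⟨ cong ∣_∣ (solve 5 (λ tx ty x y w → tx :* (x :* w) :- ty :* (y :* w) := ((tx :- ty) :* x :+ ty :* (x :- y)) :* w) refl tx ty x y w) ⟩
    ∣ ((tx - ty) * x + ty * (x - y)) * w ∣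
      ≡⟨ trans (ℚP.∣p*q∣≡∣p∣*∣q∣ ((tx - ty) * x + ty * (x - y)) w) (cong (∣ (tx - ty) * x + ty * (x - y) ∣ *_) (ℚP.0≤p⇒∣p∣≡p (inv≥0 (suc j)))) ⟩
    ∣ (tx - ty) * x + ty * (x - y) ∣ * w
      ≤⟨ *-monoʳ w (inv≥0 (suc j)) (ℚP.∣p+q∣≤∣p∣+∣q∣ ((tx - ty) * x) (ty * (x - y))) ⟩
    (∣ (tx - ty) * x ∣ + ∣ ty * (x - y) ∣) * w
      ≡⟨ cong (_* w) (cong₂ _+_ (ℚP.∣p*q∣≡∣p∣*∣q∣ (tx - ty) x) (ℚP.∣p*q∣≡∣p∣*∣q∣ ty (x - y))) ⟩
    (∣ tx - ty ∣ * ∣ x ∣ + ∣ ty ∣ * d) * w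
      ≤⟨ *-monoʳ w (inv≥0 (suc j)) (ℚP.+-mono-≤
           (*-mono (*-≥0 (ℚP.0≤∣p∣ (x - y)) (term≥0 j B≥0)) (ℚP.0≤∣p∣ x) (term-lip j h k) h)
           (*-monoʳ d (ℚP.0≤∣p∣ (x - y)) (∣term∣≤ (suc j) k))) ⟩
    (d * tj * B + tj * (B * inv j) * d) * w
      ≡⟨ cong (λ z → (z + tj * (B * inv j) * d) * w) (trans (sym (ℚP.*-identityʳ (d * tj * B))) (cong (d * tj * B *_) (sym (ι*inv j)))) ⟩
    (d * tj * B * (ι (suc j) * inv j) + tj * (B * inv j) * d) * w
      ≡⟨ solve 6 (λ d tj B s v w → (d :* tj :* B :* (s :* v) :+ tj :* (B :* v) :* d) :* w := d :* (tj :* (B :* v)) :* ((con 1ℚ :+ s) :* w)) refl d tj B (ι (suc j)) (inv j) w ⟩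
    d * (tj * (B * inv j)) * ((1ℚ + ι (suc j)) * w)
      ≡⟨ cong (d * (tj * (B * inv j)) *_) (trans (cong (_* w) (sym (ι-+ 1 (suc j)))) (ι*inv (suc j))) ⟩
    d * (tj * (B * inv j)) * 1ℚ
      ≡⟨ ℚP.*-identityʳ _ ⟩
    d * (tj * (B * inv j)) ∎
    where
    tx ty tj w d : ℚ
    tx = term (suc j) x
    ty = term (suc j) y
    tj = term j B
    w = inv (suc j)
    d = ∣ x - y ∣

  expSum-lip : ∀ m {x y} → ∣ x ∣ ≤ B → ∣ y ∣ ≤ B → ∣ expSum (suc m) x - expSum (suc m) y ∣ ≤ ∣ x - y ∣ * expSum m B
  expSum-lip zero {x} {y} h k = subst (λ z → ∣ z ∣ ≤ ∣ x - y ∣ * 1ℚ)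
    (solve 2 (λ p q → p :- q := (con 1ℚ :+ p) :- (con 1ℚ :+ q)) refl (term 1 x) (term 1 y)) (term-lip 0 h k)
  expSum-lip (suc m) {x} {y} h k = begin
    ∣ (ex + tx) - (ey + ty) ∣
      ≡⟨ cong ∣_∣ (solve 4 (λ p q r s → (p :+ r) :- (q :+ s) := (p :- q) :+ (r :- s)) refl ex ey tx ty) ⟩
    ∣ (ex - ey) + (tx - ty) ∣
      ≤⟨ ℚP.∣p+q∣≤∣p∣+∣q∣ (ex - ey) (tx - ty) ⟩
    ∣ ex - ey ∣ + ∣ tx - ty ∣
      ≤⟨ ℚP.+-mono-≤ (expSum-lip m h k) (term-lip (suc m) h k) ⟩
    ∣ x - y ∣ * expSum m B + ∣ x - y ∣ * term (suc m) B
      ≡⟨ sym (ℚP.*-distribˡ-+ ∣ x - y ∣ (expSum m B) (term (suc m) B)) ⟩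
    ∣ x - y ∣ * (expSum m B + term (suc m) B) ∎
    where
    ex ey tx ty : ℚ
    ex = expSum (suc m) x
    ey = expSum (suc m) y
    tx = term (2 ℕ.+ m) x
    ty = term (2 ℕ.+ m) y

  -- from K on, consecutive terms shrink by a factor of at least two
  halving : Eventually λ m → B * inv m ≤ ½
  halving = C*inv-null B≥0 ½>0

  K : ℕ
  K = proj₁ halving

  term-half : ∀ m → K ℕ.≤ m → term (suc m) B ≤ ½ * term m B
  term-half m h = subst (term (suc m) B ≤_) (ℚP.*-comm (term m B) ½)
    (*-monoˡ (term m B) (term≥0 m B≥0) (proj₂ halving m h))

  term-decr : ∀ m → K ℕ.≤ m → term (suc m) B ≤ term m B
  term-decr m h = ℚP.≤-trans (term-half m h) (subst (½ * term m B ≤_) (½+½ (term m B))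
    (≤+ (½ * term m B) (*-≥0 ½≥0 (term≥0 m B≥0))))

  upper : ℕ → ℚ
  upper m = expSum m B + term m B

  upper-decr : ∀ m → K ℕ.≤ m → upper (suc m) ≤ upper m
  upper-decr m h = begin
    (e + t′) + t′           ≡⟨ ℚP.+-assoc e t′ t′ ⟩
    e + (t′ + t′)           ≤⟨ ℚP.+-monoʳ-≤ e (ℚP.+-mono-≤ (term-half m h) (term-half m h)) ⟩
    e + (½ * t + ½ * t)     ≡⟨ cong (λ z → e + z) (½+½ t) ⟩
    e + t                   ∎
    where
    e t t′ : ℚ
    e = expSum m B
    t = term m B
    t′ = term (suc m) B

  expSum≤upper : ∀ {m n} → K ℕ.≤ m → m ℕ.≤ n → expSum n B ≤ upper m
  expSum≤upper {m} {n} h k = ℚP.≤-trans (≤+ (expSum n B) (term≥0 n B≥0))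
    (decr upper K upper-decr h (ℕP.≤⇒≤′ k))

  tail : ∀ {m n x} → m ℕ.≤′ n → ∣ x ∣ ≤ B → ∣ expSum n x - expSum m x ∣ ≤ expSum n B - expSum m B
  tail {m} {x = x} (ℕ.≤′-reflexive refl) h = ℚP.≤-reflexive
    (trans (cong ∣_∣ (ℚP.+-inverseʳ (expSum m x))) (sym (ℚP.+-inverseʳ (expSum m B))))
  tail {m} {suc n} {x} (ℕ.≤′-step k) h = begin
    ∣ (enx + tx) - emx ∣       ≡⟨ cong ∣_∣ (solve 3 (λ p q r → (p :+ q) :- r := (p :- r) :+ q) refl enx tx emx) ⟩
    ∣ (enx - emx) + tx ∣       ≤⟨ ℚP.∣p+q∣≤∣p∣+∣q∣ (enx - emx) tx ⟩
    ∣ enx - emx ∣ + ∣ tx ∣     ≤⟨ ℚP.+-mono-≤ (tail k h) (∣term∣≤ (suc n) h) ⟩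
    (enB - emB) + tB           ≡⟨ solve 3 (λ p q r → (p :- r) :+ q := (p :+ q) :- r) refl enB tB emB ⟩
    (enB + tB) - emB           ∎
    where
    enx emx tx enB emB tB : ℚ
    enx = expSum n x
    emx = expSum m x
    tx = term (suc n) x
    enB = expSum n B
    emB = expSum m B
    tB = term (suc n) B

  tail≤term : ∀ {m n x} → K ℕ.≤ m → m ℕ.≤ n → ∣ x ∣ ≤ B → ∣ expSum n x - expSum m x ∣ ≤ term m B
  tail≤term h k l = ℚP.≤-trans (tail (ℕP.≤⇒≤′ k) l) (≤+⇒-≤ (expSum≤upper h k))

  term-null : ∀ {ε} → 0ℚ < ε → Eventually λ m → term m B ≤ ε
  term-null {ε} ε>0 =
    let N , h = C*inv-null (*-≥0 (term≥0 K B≥0) B≥0) ε>0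
    in suc (N ℕ.⊔ K) , λ { (suc m) (ℕ.s≤s l) → begin
         term m B * (B * inv m)   ≤⟨ *-monoʳ (B * inv m) (*-≥0 B≥0 (inv≥0 m))
                                      (decr (λ i → term i B) K term-decr ℕP.≤-refl (ℕP.≤⇒≤′ (ℕP.≤-trans (ℕP.m≤n⊔m N K) l))) ⟩
         term K B * (B * inv m)   ≡⟨ sym (ℚP.*-assoc (term K B) B (inv m)) ⟩
         term K B * B * inv m     ≤⟨ h m (ℕP.≤-trans (ℕP.m≤m⊔n N K) l) ⟩
         ε ∎ }

  uniform : ∀ {ε} → 0ℚ < ε → ∃[ N ] ∀ m n x → N ℕ.≤ m → N ℕ.≤ n → ∣ x ∣ ≤ B → ∣ expSum m x - expSum n x ∣ ≤ ε
  uniform {ε} ε>0 = N ℕ.⊔ K , λ m n x h k l → go m n x h k l (ℕP.≤-total m n)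
    where
    N : ℕ
    N = proj₁ (term-null ε>0)
    go : ∀ m n x → N ℕ.⊔ K ℕ.≤ m → N ℕ.⊔ K ℕ.≤ n → ∣ x ∣ ≤ B → m ℕ.≤ n ⊎ n ℕ.≤ m → ∣ expSum m x - expSum n x ∣ ≤ ε
    go m n x h k l (inj₁ m≤n) = subst (_≤ ε) (∣-∣-sym (expSum n x) (expSum m x))
      (ℚP.≤-trans (tail≤term (ℕP.≤-trans (ℕP.m≤n⊔m N K) h) m≤n l)
        (proj₂ (term-null ε>0) m (ℕP.≤-trans (ℕP.m≤m⊔n N K) h)))
    go m n x h k l (inj₂ n≤m) =
      ℚP.≤-trans (tail≤term (ℕP.≤-trans (ℕP.m≤n⊔m N K) k) n≤m l)
        (proj₂ (term-null ε>0) n (ℕP.≤-trans (ℕP.m≤m⊔n N K) k))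

  Lip : ℚ
  Lip = upper K

  Lip≥0 : 0ℚ ≤ Lip
  Lip≥0 = +-≥0 (expSum≥0 K B≥0) (term≥0 K B≥0)

  lipschitz : ∀ m {x y} → suc K ℕ.≤ m → ∣ x ∣ ≤ B → ∣ y ∣ ≤ B → ∣ expSum m x - expSum m y ∣ ≤ Lip * ∣ x - y ∣
  lipschitz (suc m) {x} {y} (ℕ.s≤s h) k l = ℚP.≤-trans (expSum-lip m k l)
    (subst (∣ x - y ∣ * expSum m B ≤_) (ℚP.*-comm ∣ x - y ∣ Lip)
      (*-monoˡ ∣ x - y ∣ (ℚP.0≤∣p∣ (x - y)) (expSum≤upper ℕP.≤-refl h)))

IsCauchy : (ℕ → ℚ) → Set
IsCauchy x = ∀ {ε} → 0ℚ < ε → ∃[ N ] ∀ m n → N ℕ.≤ m → N ℕ.≤ n → ∣ x m - x n ∣ ≤ ε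

record ℝ : Set where
  constructor mkℝ
  field
    seq    : ℕ → ℚ
    cauchy : IsCauchy seq

open ℝ public

infix 4 _≃ᴿ_ _≤ᴿ_ _<ᴿ_

_≃ᴿ_ : Rel ℝ 0ℓ
x ≃ᴿ y = ∀ {ε} → 0ℚ < ε → Eventually λ m → ∣ seq x m - seq y m ∣ ≤ ε

_≤ᴿ_ : Rel ℝ 0ℓ
x ≤ᴿ y = ∀ {ε} → 0ℚ < ε → Eventually λ m → seq x m ≤ seq y m + ε

_<ᴿ_ : Rel ℝ 0ℓ
x <ᴿ y = ∃[ ε ] 0ℚ < ε × Eventually λ m → seq x m + ε ≤ seq y m

fromℚ : ℚ → ℝ
fromℚ q = mkℝ (λ _ → q) λ ε>0 → 0 , λ _ _ _ _ →
  subst (_≤ _) (sym (cong ∣_∣ (ℚP.+-inverseʳ q))) (ℚP.<⇒≤ ε>0)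

fromℕ : ℕ → ℝ
fromℕ n = fromℚ (ι n)

0ᴿ : ℝ
0ᴿ = fromℚ 0ℚ

bounded : ∀ (x : ℝ) → ∃[ B ] 0ℚ ≤ B × Eventually λ m → ∣ seq x m ∣ ≤ B
bounded x =
  let N , h = cauchy x (ℚP.positive⁻¹ 1ℚ)
      a = seq x N
  in 1ℚ + ∣ a ∣ , +-≥0 1≥0 (ℚP.0≤∣p∣ a) , N , λ m l → begin
    ∣ seq x m ∣            ≡⟨ cong ∣_∣ (solve 2 (λ p q → p := (p :- q) :+ q) refl (seq x m) a) ⟩
    ∣ (seq x m - a) + a ∣  ≤⟨ ℚP.∣p+q∣≤∣p∣+∣q∣ (seq x m - a) a ⟩
    ∣ seq x m - a ∣ + ∣ a ∣ ≤⟨ ℚP.+-monoˡ-≤ ∣ a ∣ (h m N l ℕP.≤-refl) ⟩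
    1ℚ + ∣ a ∣             ∎

½*>0 : ∀ {ε} → 0ℚ < ε → 0ℚ < ½ * ε
½*>0 = *->0 ½>0

⊔ˡ : ∀ {a b m} → a ℕ.⊔ b ℕ.≤ m → a ℕ.≤ m
⊔ˡ {a} {b} = ℕP.≤-trans (ℕP.m≤m⊔n a b)

⊔ʳ : ∀ {a b m} → a ℕ.⊔ b ℕ.≤ m → b ℕ.≤ m
⊔ʳ {a} {b} = ℕP.≤-trans (ℕP.m≤n⊔m a b)

infixl 7 _*ᴿ_

_*ᴿ_ : ℝ → ℝ → ℝ
x *ᴿ y = mkℝ (λ m → seq x m * seq y m) isCauchy
  where
  isCauchy : IsCauchy λ m → seq x m * seq y m
  isCauchy {ε} ε>0 =
    let A , A≥0 , N₁ , hA = bounded x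
        B , B≥0 , N₂ , hB = bounded y
        δ , δ>0 , hδ = shrink A≥0 (½*>0 ε>0)
        η , η>0 , hη = shrink B≥0 (½*>0 ε>0)
        N₃ , hy = cauchy y δ>0
        N₄ , hx = cauchy x η>0
    in (N₁ ℕ.⊔ N₂) ℕ.⊔ (N₃ ℕ.⊔ N₄) , λ m n hm hn →
      let a = seq x m ; b = seq y m ; c = seq x n ; d = seq y n in begin
      ∣ a * b - c * d ∣
        ≡⟨ cong ∣_∣ (solve 4 (λ a b c d → a :* b :- c :* d := a :* (b :- d) :+ d :* (a :- c)) refl a b c d) ⟩
      ∣ a * (b - d) + d * (a - c) ∣
        ≤⟨ ℚP.∣p+q∣≤∣p∣+∣q∣ (a * (b - d)) (d * (a - c)) ⟩
      ∣ a * (b - d) ∣ + ∣ d * (a - c) ∣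
        ≡⟨ cong₂ _+_ (ℚP.∣p*q∣≡∣p∣*∣q∣ a (b - d)) (ℚP.∣p*q∣≡∣p∣*∣q∣ d (a - c)) ⟩
      ∣ a ∣ * ∣ b - d ∣ + ∣ d ∣ * ∣ a - c ∣
        ≤⟨ ℚP.+-mono-≤
             (*-mono A≥0 (ℚP.0≤∣p∣ (b - d)) (hA m (⊔ˡ (⊔ˡ hm))) (hy m n (⊔ˡ (⊔ʳ {N₁ ℕ.⊔ N₂} hm)) (⊔ˡ (⊔ʳ {N₁ ℕ.⊔ N₂} hn))))
             (*-mono B≥0 (ℚP.0≤∣p∣ (a - c)) (hB n (⊔ʳ {N₁} (⊔ˡ hn))) (hx m n (⊔ʳ {N₃} (⊔ʳ {N₁ ℕ.⊔ N₂} hm)) (⊔ʳ {N₃} (⊔ʳ {N₁ ℕ.⊔ N₂} hn)))) ⟩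
      A * δ + B * η
        ≤⟨ ℚP.+-mono-≤ hδ hη ⟩
      ½ * ε + ½ * ε
        ≡⟨ ½+½ ε ⟩
      ε ∎

-- total reciprocal, sending 0 to 0
recip : ℚ → ℚ
recip q with q ≟ 0ℚ
... | yes _   = 0ℚ
... | no  q≢0 = (1/ q) {{≢-nonZero q≢0}}

recip-inverse : ∀ q → q ≢ 0ℚ → recip q * q ≡ 1ℚ
recip-inverse q q≢0 with q ≟ 0ℚ
... | yes q≡0 = contradiction q≡0 q≢0
... | no  _   = ℚP.*-inverseˡ q {{≢-nonZero q≢0}}

recip-inverse⁺ : ∀ {q} → 0ℚ < q → recip q * q ≡ 1ℚ
recip-inverse⁺ {q} h = recip-inverse q λ q≡0 → ℚP.<-irrefl (sym q≡0) h

recip≥0 : ∀ {q} → 0ℚ < q → 0ℚ ≤ recip q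
recip≥0 {q} h = ℚP.*-cancelʳ-≤-pos q {{positive h}}
  (subst₂ _≤_ (sym (ℚP.*-zeroˡ q)) (sym (recip-inverse⁺ h)) 1≥0)

recip-anti : ∀ {e a} → 0ℚ < e → e ≤ a → recip a ≤ recip e
recip-anti {e} {a} e>0 e≤a = begin
  ra                ≡⟨ sym (ℚP.*-identityʳ ra) ⟩
  ra * 1ℚ           ≡⟨ cong (ra *_) (sym (recip-inverse⁺ e>0)) ⟩
  ra * (re * e)     ≤⟨ *-monoˡ ra (recip≥0 a>0) (*-monoˡ re (recip≥0 e>0) e≤a) ⟩
  ra * (re * a)     ≡⟨ solve 3 (λ x y z → x :* (y :* z) := y :* (x :* z)) refl ra re a ⟩
  re * (ra * a)     ≡⟨ cong (re *_) (recip-inverse⁺ a>0) ⟩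
  re * 1ℚ           ≡⟨ ℚP.*-identityʳ re ⟩
  re                ∎
  where
  a>0 : 0ℚ < a
  a>0 = ℚP.<-≤-trans e>0 e≤a
  ra re : ℚ
  ra = recip a
  re = recip e

recip-lip : ∀ {e a b} → 0ℚ < e → e ≤ a → e ≤ b → ∣ recip a - recip b ∣ ≤ recip e * recip e * ∣ a - b ∣
recip-lip {e} {a} {b} e>0 e≤a e≤b = begin
  ∣ ra - rb ∣
    ≡⟨ cong ∣_∣ (cong₂ _-_ (trans (sym (ℚP.*-identityʳ ra)) (cong (ra *_) (sym (recip-inverse⁺ b>0))))
                          (trans (sym (ℚP.*-identityʳ rb)) (cong (rb *_) (sym (recip-inverse⁺ a>0))))) ⟩
  ∣ ra * (rb * b) - rb * (ra * a) ∣
    ≡⟨ cong ∣_∣ (solve 4 (λ p q x y → p :* (q :* y) :- q :* (p :* x) := (p :* q) :* (y :- x)) refl ra rb a b) ⟩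
  ∣ (ra * rb) * (b - a) ∣
    ≡⟨ trans (ℚP.∣p*q∣≡∣p∣*∣q∣ (ra * rb) (b - a)) (cong₂ _*_ (ℚP.0≤p⇒∣p∣≡p (*-≥0 (recip≥0 a>0) (recip≥0 b>0))) (∣-∣-sym b a)) ⟩
  (ra * rb) * ∣ a - b ∣
    ≤⟨ *-monoʳ ∣ a - b ∣ (ℚP.0≤∣p∣ (a - b)) (*-mono (recip≥0 e>0) (recip≥0 b>0) (recip-anti e>0 e≤a) (recip-anti e>0 e≤b)) ⟩
  recip e * recip e * ∣ a - b ∣ ∎
  where
  a>0 : 0ℚ < a
  a>0 = ℚP.<-≤-trans e>0 e≤a
  b>0 : 0ℚ < b
  b>0 = ℚP.<-≤-trans e>0 e≤b
  ra rb : ℚ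
  ra = recip a
  rb = recip b

-- The sign hypothesis is needed only for the Cauchy condition; the finitely many terms that may vanish are harmless.
recipᴿ : (y : ℝ) → 0ᴿ <ᴿ y → ℝ
recipᴿ y (e , e>0 , N , h) = mkℝ (λ m → recip (seq y m)) isCauchy
  where
  low : ∀ m → N ℕ.≤ m → e ≤ seq y m
  low m l = subst (_≤ seq y m) (ℚP.+-identityˡ e) (h m l)
  isCauchy : IsCauchy λ m → recip (seq y m)
  isCauchy {ε} ε>0 =
    let δ , δ>0 , hδ = shrink (*-≥0 (recip≥0 e>0) (recip≥0 e>0)) ε>0
        M , k = cauchy y δ>0
    in N ℕ.⊔ M , λ m n hm hn →
      ℚP.≤-trans (recip-lip e>0 (low m (⊔ˡ hm)) (low n (⊔ˡ hn)))
        (ℚP.≤-trans (*-monoˡ (recip e * recip e) (*-≥0 (recip≥0 e>0) (recip≥0 e>0)) (k m n (⊔ʳ {N} hm) (⊔ʳ {N} hn))) hδ)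

infixl 7 _/ᴿ_[_]

_/ᴿ_[_] : ℝ → (y : ℝ) → 0ᴿ <ᴿ y → ℝ
x /ᴿ y [ y>0 ] = x *ᴿ recipᴿ y y>0

-- The diagonal sequence Σ_{i ≤ m} (xₘ)ⁱ / i! converges to Σᵢ xⁱ / i!, since the series converges uniformly
-- on bounded sets.
exp : ℝ → ℝ
exp x = mkℝ (λ m → expSum m (seq x m)) isCauchy
  where
  isCauchy : IsCauchy λ m → expSum m (seq x m)
  isCauchy {ε} ε>0 =
    let B , B≥0 , N₁ , hB = bounded x
        open OnBall B B≥0
        N₂ , hU = uniform (½*>0 ε>0)
        δ , δ>0 , hδ = shrink Lip≥0 (½*>0 ε>0)
        N₃ , hx = cauchy x δ>0
    in (N₁ ℕ.⊔ N₂) ℕ.⊔ (suc K ℕ.⊔ N₃) , λ m n hm hn →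
      let a = seq x m ; b = seq x n
          ha = hB m (⊔ˡ (⊔ˡ hm)) ; hb = hB n (⊔ˡ (⊔ˡ hn)) in begin
      ∣ expSum m a - expSum n b ∣
        ≤⟨ ∣-∣-tri (expSum m a) (expSum m b) (expSum n b) ⟩
      ∣ expSum m a - expSum m b ∣ + ∣ expSum m b - expSum n b ∣
        ≤⟨ ℚP.+-mono-≤
             (ℚP.≤-trans (lipschitz m (⊔ˡ {suc K} {N₃} (⊔ʳ {N₁ ℕ.⊔ N₂} hm)) ha hb)
               (ℚP.≤-trans (*-monoˡ Lip Lip≥0 (hx m n (⊔ʳ {suc K} (⊔ʳ {N₁ ℕ.⊔ N₂} hm)) (⊔ʳ {suc K} (⊔ʳ {N₁ ℕ.⊔ N₂} hn)))) hδ))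
             (hU m n b (⊔ʳ {N₁} (⊔ˡ hm)) (⊔ʳ {N₁} (⊔ˡ hn)) hb) ⟩
      ½ * ε + ½ * ε
        ≡⟨ ½+½ ε ⟩
      ε ∎

greatest : ∀ {P : ℕ → Set} → (∀ j → Dec (P j)) → ℕ → ℕ
greatest P? zero    = zero
greatest P? (suc J) with P? (suc J)
... | yes _ = suc J
... | no  _ = greatest P? J

greatest-sat : ∀ {P : ℕ → Set} (P? : ∀ j → Dec (P j)) J → P 0 → P (greatest P? J)
greatest-sat P? zero    p = p
greatest-sat P? (suc J) p with P? (suc J)
... | yes q = q
... | no  _ = greatest-sat P? J p

greatest-≤ : ∀ {P : ℕ → Set} (P? : ∀ j → Dec (P j)) J → greatest P? J ℕ.≤ J
greatest-≤ P? zero    = ℕ.z≤n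
greatest-≤ P? (suc J) with P? (suc J)
... | yes _ = ℕP.≤-refl
... | no  _ = ℕP.m≤n⇒m≤1+n (greatest-≤ P? J)

greatest-max : ∀ {P : ℕ → Set} (P? : ∀ j → Dec (P j)) J {j} → j ℕ.≤ J → P j → j ℕ.≤ greatest P? J
greatest-max P? zero    h p = h
greatest-max P? (suc J) h p with P? (suc J)
... | yes _  = h
... | no ¬q with ℕP.m≤n⇒m<n∨m≡n h
...   | inj₁ (ℕ.s≤s l) = greatest-max P? J l p
...   | inj₂ refl      = contradiction p ¬q

step : ℕ → ℚ
step m = ½ * inv m

step≥0 : ∀ m → 0ℚ ≤ step m
step≥0 m = *-≥0 ½≥0 (inv≥0 m)

-- grid m j = j / (2 (m + 1))
grid : ℕ → ℕ → ℚ
grid m j = ι j * step m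

grid≥0 : ∀ m j → 0ℚ ≤ grid m j
grid≥0 m j = *-≥0 (ι≥0 j) (step≥0 m)

ι-mono : ∀ {i j} → i ℕ.≤ j → ι i ≤ ι j
ι-mono {i} {j} h = subst (ι i ≤_) (trans (sym (ι-+ i (j ℕ.∸ i))) (cong ι (ℕP.m+[n∸m]≡n h))) (≤+ (ι i) (ι≥0 (j ℕ.∸ i)))

grid-mono : ∀ m {i j} → i ℕ.≤ j → grid m i ≤ grid m j
grid-mono m h = *-monoʳ (step m) (step≥0 m) (ι-mono h)

grid-suc : ∀ m j → grid m (suc j) ≡ grid m j + step m
grid-suc m j = trans (cong (_* step m) (ι-+ 1 j))
  (solve 2 (λ a s → (con 1ℚ :+ a) :* s := a :* s :+ s) refl (ι j) (step m))

grid-½ : ∀ m → grid m (suc m) ≡ ½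
grid-½ m = trans (solve 3 (λ a h v → a :* (h :* v) := h :* (a :* v)) refl (ι (suc m)) ½ (inv m))
  (trans (cong (½ *_) (ι*inv m)) (ℚP.*-identityʳ ½))

top : ℕ → ℕ → ℕ
top n m = (n ℕ.* 2) ℕ.* suc m

grid-top : ∀ n m → grid m (top n m) ≡ ι n
grid-top n m = begin-equality
  ι (top n m) * (½ * inv m)              ≡⟨ cong (_* step m) (trans (ι-* (n ℕ.* 2) (suc m)) (cong (_* ι (suc m)) (ι-* n 2))) ⟩
  ι n * ι 2 * ι (suc m) * (½ * inv m)    ≡⟨ solve 5 (λ a b c d e → a :* b :* c :* (d :* e) := a :* (b :* d) :* (c :* e)) refl (ι n) (ι 2) (ι (suc m)) ½ (inv m) ⟩
  ι n * (ι 2 * ½) * (ι (suc m) * inv m)  ≡⟨ cong (ι n * 1ℚ *_) (ι*inv m) ⟩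
  ι n * 1ℚ * 1ℚ                          ≡⟨ trans (ℚP.*-identityʳ (ι n * 1ℚ)) (ℚP.*-identityʳ (ι n)) ⟩
  ι n                                    ∎

Below : ℕ → ℕ → ℕ → Set
Below n m j = expSum m (grid m j) ≤ ι n

below? : ∀ n m j → Dec (Below n m j)
below? n m j = expSum m (grid m j) ≤? ι n

index : ℕ → ℕ → ℕ
index n m = greatest (below? n m) (top n m)

logSeq : ℕ → ℕ → ℚ
logSeq n m = grid m (index n m)

logSeq≥0 : ∀ n m → 0ℚ ≤ logSeq n m
logSeq≥0 n m = grid≥0 m (index n m)

logSeq≤ : ∀ n m → logSeq n m ≤ ι n
logSeq≤ n m = subst (logSeq n m ≤_) (grid-top n m) (grid-mono m (greatest-≤ (below? n m) (top n m)))

expSum-0 : ∀ m → expSum m 0ℚ ≡ 1ℚ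
expSum-0 zero    = refl
expSum-0 (suc m) = trans (cong₂ _+_ (expSum-0 m)
  (trans (cong (term m 0ℚ *_) (ℚP.*-zeroˡ (inv m))) (ℚP.*-zeroʳ (term m 0ℚ)))) (ℚP.+-identityʳ 1ℚ)

module LogSeq (p : ℕ) where

  n : ℕ
  n = suc p

  open OnBall (ι n) (ι≥0 n)

  below-0 : ∀ m → Below n m 0
  below-0 m = subst (_≤ ι n) (sym (trans (cong (expSum m) (ℚP.*-zeroˡ (step m))) (expSum-0 m))) (ι-mono {1} {n} (ℕ.s≤s ℕ.z≤n))

  below-index : ∀ m → expSum m (logSeq n m) ≤ ι n
  below-index m = greatest-sat (below? n m) (top n m) (below-0 m)

  ¬below-top : ∀ m → ¬ Below n (suc m) (top n (suc m))
  ¬below-top m h = ℚP.<-irrefl refl (begin-strict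
    ι n                                     ≡⟨ solve 1 (λ a → a := a :+ con 0ℚ) refl (ι n) ⟩
    ι n + 0ℚ                                <⟨ ℚP.+-monoʳ-< (ι n) (ℚP.positive⁻¹ 1ℚ) ⟩
    ι n + 1ℚ                                ≡⟨ solve 1 (λ a → a :+ con 1ℚ := con 1ℚ :+ (a :- con 0ℚ)) refl (ι n) ⟩
    1ℚ + (ι n - 0ℚ)                         ≤⟨ ℚP.+-monoʳ-≤ 1ℚ (expSum-expands m ℚP.≤-refl (ι≥0 n)) ⟩
    1ℚ + (expSum (suc m) (ι n) - expSum (suc m) 0ℚ)
      ≡⟨ cong (λ z → 1ℚ + (expSum (suc m) (ι n) - z)) (expSum-0 (suc m)) ⟩
    1ℚ + (expSum (suc m) (ι n) - 1ℚ)        ≡⟨ solve 1 (λ a → con 1ℚ :+ (a :- con 1ℚ) := a) refl (expSum (suc m) (ι n)) ⟩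
    expSum (suc m) (ι n)                    ≡⟨ cong (expSum (suc m)) (sym (grid-top n (suc m))) ⟩
    expSum (suc m) (grid (suc m) (top n (suc m)))  ≤⟨ h ⟩
    ι n                                     ∎)

  index<top : ∀ m → suc (index n (suc m)) ℕ.≤ top n (suc m)
  index<top m = ℕP.≤∧≢⇒< (greatest-≤ (below? n (suc m)) (top n (suc m)))
    λ e → ¬below-top m (subst (Below n (suc m)) e (below-index (suc m)))

  above : ∀ m → ι n ≤ expSum (suc m) (logSeq n (suc m) + step (suc m))
  above m = subst (λ z → ι n ≤ expSum (suc m) z) (grid-suc (suc m) (index n (suc m)))
    (ℚP.<⇒≤ (ℚP.≰⇒> λ h → ℕP.<-irrefl refl (greatest-max (below? n (suc m)) (top n (suc m)) (index<top m) h)))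

  above≤ : ∀ m → logSeq n (suc m) + step (suc m) ≤ ι n
  above≤ m = subst₂ _≤_ (grid-suc (suc m) (index n (suc m))) (grid-top n (suc m)) (grid-mono (suc m) (index<top m))

  ∣logSeq∣≤ : ∀ m → ∣ logSeq n m ∣ ≤ ι n
  ∣logSeq∣≤ m = subst (_≤ ι n) (sym (ℚP.0≤p⇒∣p∣≡p (logSeq≥0 n m))) (logSeq≤ n m)

  error : ∀ m → suc K ℕ.≤ suc m → ∣ expSum (suc m) (logSeq n (suc m)) - ι n ∣ ≤ Lip * step (suc m)
  error m h = begin
    ∣ expSum (suc m) l - ι n ∣                          ≡⟨ ∣-∣-≤ (below-index (suc m)) ⟩
    ι n - expSum (suc m) l                              ≤⟨ ℚP.+-monoˡ-≤ (- expSum (suc m) l) (above m) ⟩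
    expSum (suc m) l′ - expSum (suc m) l                ≤⟨ p≤∣p∣ (expSum (suc m) l′ - expSum (suc m) l) ⟩
    ∣ expSum (suc m) l′ - expSum (suc m) l ∣            ≤⟨ lipschitz (suc m) h
                                                             (subst (_≤ ι n) (sym (ℚP.0≤p⇒∣p∣≡p l′≥0)) (above≤ m))
                                                             (∣logSeq∣≤ (suc m)) ⟩
    Lip * ∣ l′ - l ∣                                    ≡⟨ cong (Lip *_) (trans (cong ∣_∣ (solve 2 (λ a s → a :+ s :- a := s) refl l (step (suc m)))) (ℚP.0≤p⇒∣p∣≡p (step≥0 (suc m)))) ⟩
    Lip * step (suc m)                                  ∎
    where
    l l′ : ℚ
    l = logSeq n (suc m)
    l′ = l + step (suc m)
    l′≥0 : 0ℚ ≤ l′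
    l′≥0 = +-≥0 (logSeq≥0 n (suc m)) (step≥0 (suc m))

  converges : ∀ {ε} → 0ℚ < ε → Eventually λ m → ∣ expSum m (logSeq n m) - ι n ∣ ≤ ε
  converges {ε} ε>0 =
    let N , h = C*inv-null (*-≥0 Lip≥0 ½≥0) ε>0
    in suc K ℕ.⊔ N , λ { (suc m) l → ℚP.≤-trans (error m (⊔ˡ {suc K} {N} l))
         (subst (_≤ ε) (ℚP.*-assoc Lip ½ (inv (suc m))) (h (suc m) (⊔ʳ {suc K} {N} l)))
       ; zero l → contradiction (⊔ˡ {suc K} {N} l) λ () }

  isCauchy : IsCauchy (logSeq n)
  isCauchy {ε} ε>0 =
    let N₁ , h = converges (½*>0 (½*>0 ε>0))
        N₂ , hU = uniform (½*>0 ε>0)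
    in suc (N₁ ℕ.⊔ N₂) , λ
      { (suc m) k hm hk →
        let lm = logSeq n (suc m) ; lk = logSeq n k
            hm′ = ℕP.≤-trans (ℕP.n≤1+n (N₁ ℕ.⊔ N₂)) hm ; hk′ = ℕP.≤-trans (ℕP.n≤1+n (N₁ ℕ.⊔ N₂)) hk in begin
        ∣ lm - lk ∣
          ≤⟨ expSum-expands-∣∣ m (logSeq≥0 n (suc m)) (logSeq≥0 n k) ⟩
        ∣ expSum (suc m) lm - expSum (suc m) lk ∣
          ≤⟨ ∣-∣-tri (expSum (suc m) lm) (expSum k lk) (expSum (suc m) lk) ⟩
        ∣ expSum (suc m) lm - expSum k lk ∣ + ∣ expSum k lk - expSum (suc m) lk ∣
          ≤⟨ ℚP.+-mono-≤
               (ℚP.≤-trans (∣-∣-tri (expSum (suc m) lm) (ι n) (expSum k lk))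
                 (ℚP.+-mono-≤ (h (suc m) (⊔ˡ {N₁} {N₂} hm′))
                   (subst (_≤ ½ * (½ * ε)) (∣-∣-sym (expSum k lk) (ι n)) (h k (⊔ˡ {N₁} {N₂} hk′)))))
               (hU k (suc m) lk (⊔ʳ {N₁} {N₂} hk′) (⊔ʳ {N₁} {N₂} hm′) (∣logSeq∣≤ k)) ⟩
        (½ * (½ * ε) + ½ * (½ * ε)) + ½ * ε
          ≡⟨ trans (cong (λ z → z + ½ * ε) (½+½ (½ * ε))) (½+½ ε) ⟩
        ε ∎ }

-- The natural logarithm of a positive integer n: its m-th approximation is the largest multiple x of
-- 1 / (2 (m + 1)) in [0 , n] with Σ_{i ≤ m} xⁱ / i! ≤ n.  By exp-log this is the inverse of exp; log 0 is a junk value.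
log : ℕ → ℝ
log zero    = 0ᴿ
log (suc p) = mkℝ (logSeq (suc p)) (LogSeq.isCauchy p)

exp-log : ∀ n → 0 ℕ.< n → exp (log n) ≃ᴿ fromℕ n
exp-log (suc p) _ = LogSeq.converges p

expSum-½ : ∀ m → expSum m ½ + term m ½ ≤ ι 2
expSum-½ zero    = ℚP.≤-refl
expSum-½ (suc m) = begin
  (e + t′) + t′        ≡⟨ ℚP.+-assoc e t′ t′ ⟩
  e + (t′ + t′)        ≤⟨ ℚP.+-monoʳ-≤ e (ℚP.+-mono-≤ half half) ⟩
  e + (½ * t + ½ * t)  ≡⟨ cong (λ z → e + z) (½+½ t) ⟩
  e + t                ≤⟨ expSum-½ m ⟩
  ι 2                  ∎
  where
  e t t′ : ℚ
  e = expSum m ½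
  t = term m ½
  t′ = term (suc m) ½
  half : t′ ≤ ½ * t
  half = begin
    t * (½ * inv m)    ≤⟨ *-monoˡ t (term≥0 m ½≥0) (*-monoˡ ½ ½≥0 (inv-anti {0} {m} ℕ.z≤n)) ⟩
    t * (½ * 1ℚ)       ≡⟨ trans (cong (t *_) (ℚP.*-identityʳ ½)) (ℚP.*-comm t ½) ⟩
    ½ * t              ∎

log-pos : ∀ {n} → 1 ℕ.< n → 0ᴿ <ᴿ log n
log-pos {n@(suc (suc q))} 1<n@(ℕ.s≤s (ℕ.s≤s ℕ.z≤n)) = ½ , ½>0 , 0 , λ m _ →
  subst (_≤ logSeq n m) (trans (grid-½ m) (sym (ℚP.+-identityˡ ½)))
    (grid-mono m (greatest-max (below? n m) (top n m) (ℕP.m≤n*m (suc m) (n ℕ.* 2)) (below m)))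
  where
  below : ∀ m → Below n m (suc m)
  below m = subst (λ z → expSum m z ≤ ι n) (sym (grid-½ m))
    (ℚP.≤-trans (≤+ (expSum m ½) (term≥0 m ½≥0)) (ℚP.≤-trans (expSum-½ m) (ι-mono 1<n)))

record FinPoset (n : ℕ) : Set₁ where
  field
    _≼_               : Rel (Fin n) 0ℓ
    isDecPartialOrder : IsDecPartialOrder _≡_ _≼_

record LinearExtension {n} (P : FinPoset n) : Set₁ where
  open FinPoset P
  field
    _⊑_          : Rel (Fin n) 0ℓ
    isTotalOrder : IsTotalOrder _≡_ _⊑_
    extends      : _≼_ ⇒ _⊑_

-- The setoid equality is extensional, so each total order is counted once.
linearExtensions : ∀ {n} → FinPoset n → Setoid _ _
linearExtensions P = record
  { Carrier       = LinearExtension P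
  ; _≈_           = λ L M → ∀ i j → LinearExtension._⊑_ L i j ⇔ LinearExtension._⊑_ M i j
  ; isEquivalence = record
    { refl  = λ i j → ⇔-id _
    ; sym   = λ e i j → ⇔-sym (e i j)
    ; trans = λ e f i j → f i j ⇔-∘ e i j
    }
  }

infix 4 ext_≐_

-- "ext(P) = k": the set of linear extensions of P has cardinality k.
ext_≐_ : ∀ {n} → FinPoset n → ℕ → Set₁
ext P ≐ k = Inverse (setoid (Fin k)) (linearExtensions P)

LE : ℕ → Pred ℕ _
LE n k = Σ (FinPoset n) λ P → ext P ≐ k

{-# OPTIONS --safe #-}

-- Let x be a maximal element of P, and suppose that P has a linear extensions, b of which end with x.  Adding y
-- above everything except x gives a + b linear extensions: a of them end with y and b end with x.  Adding y above
-- everything gives (a , a).  So the subtractive Euclidean algorithm for a coprime pair (p , m), run backwards,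
-- multiplies the number of linear extensions by p, at the cost of one element more than its number of steps, and it
-- suffices to find, for each prime p, an m for which that number is O(log p · log log k), where k is the given integer.
--
-- If a is a quotient of the Euclidean algorithm for (p , m), r the divisor and q the corresponding continuant, then
-- q m ≡ ± r (mod p) and a q r ≤ p.  For given q, r and sign only one m is possible, so, on average over m, there are
-- O(log p / T) pairs (q , r) with T q r ≤ p, and the quotients below T sum to O(log p · log T).  With T of order
-- log k some m has only quotients below T, with sum O(log p · log T).

module Submission where

open import Data.Fin.Base using (Fin; zero; suc)
open import Data.Fin.Properties using (+↔⊎; suc-injective) renaming (_≟_ to _≟ᶠ_)
open import Data.List.Base using ([]; _∷_)
open import Data.List.Relation.Unary.All using (All; []; _∷_)
open import Data.Nat.Base using (ℕ; zero; suc; _+_; _*_; _∸_; _^_; _/_; _%_; _≤_; _<_; z≤n; s≤s; s<s; s<s⁻¹; s≤s⁻¹; NonZero; >-nonZero; nonTrivial⇒n>1)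
open import Data.Nat.DivMod using (m≡m%n+[m/n]*n; m%n<n; m/n*n≤m; m≥n⇒m/n>0; m/n/o≡m/[n*o]; m*n/n≡m; /-monoˡ-≤; m<n⇒m%n≡m; [m+kn]%n≡m%n; /-monoʳ-≤; n/1≡n)
open import Data.Nat.Divisibility using (_∣_; _∣?_; divides; ∣⇒≤; ∣-refl; ∣m∣n⇒∣m+n; ∣n⇒∣m*n; m%n≡0⇒n∣m)
open import Data.Nat.Induction using (<-wellFounded)
open import Data.Nat.ListAction using (product)
open import Data.Nat.Primality using (Prime; euclidsLemma; prime⇒irreducible; prime⇒nonTrivial; productOfPrimes≥1)
open import Data.Nat.Primality.Factorisation using (PrimeFactorisation; factorise)
open import Data.Nat.Properties hiding (suc-injective)
import Data.Nat.Properties as ℕ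
open import Data.Nat.Tactic.RingSolver using (solve-∀)
open import Data.Product.Base using (∃-syntax; _×_; _,_; proj₁; proj₂)
import Data.Rational.Base as ℚ
open import Data.Rational.Base using (ℚ; 0ℚ; 1ℚ; ½)
import Data.Rational.Properties as ℚ
open import Data.Rational.Solver using (module +-*-Solver)
open import Data.Sum.Base using (_⊎_; inj₁; inj₂)
open import Data.Sum.Function.Setoid using (_⊎-inverse_)
open import Data.Sum.Relation.Binary.Pointwise using (_⊎ₛ_; Pointwise-≡↔≡; inj₁; inj₂)
open import Data.Unit.Base using (⊤; tt)
open import Function.Base using (_∘_; id)
open import Function.Bundles using (Inverse; _⇔_; mk⇔; Equivalence)
open import Function.Consequences.Setoid using (strictlyInverseˡ⇒inverseˡ; strictlyInverseʳ⇒inverseʳ)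
open import Function.Construct.Composition using (inverse)
open import Function.Construct.Identity using (⇔-id)
open import Function.Construct.Symmetry using () renaming (inverse to inverse-sym)
open import Induction.WellFounded using (Acc; acc)
open import Level using (0ℓ)
open import Relation.Binary.Bundles using (Setoid)
open import Relation.Binary.Construct.On using () renaming (setoid to on-setoid)
open import Relation.Binary.Core using (Rel)
open import Relation.Binary.PropositionalEquality using (_≡_; _≢_; refl; sym; trans; cong; cong₂; subst; subst₂)
open import Relation.Binary.PropositionalEquality.Properties using (setoid; isEquivalence)
open import Relation.Binary.Structures using (IsPartialOrder; IsDecPartialOrder; IsTotalOrder)
open import Relation.Nullary using (¬_; Dec; yes; no; contradiction; ¬?)
open import Relation.Unary using (Pred; Decidable; ∅; U; _∈_)

open import Defs using (0ᴿ; _<ᴿ_; _≤ᴿ_; _*ᴿ_; _/ᴿ_[_]; fromℚ; fromℕ; exp; log; log-pos)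
open import Defs using (FinPoset; LinearExtension; linearExtensions; ext_≐_; LE)
open import Defs using (ι; ι≥0; ι-+; ι-*; ι-mono; inv; inv≥0; inv>0; ι*inv; *-≥0; *->0; *-monoˡ; *-mono; +-≥0; ≤+; p≤∣p∣; ½≥0; ½>0)
open import Defs using (term≥0; expSum; expSum-0; expSum-mono; module OnBall; recip; recip≥0; recip-anti; recip-inverse⁺)
open import Defs using (logSeq; grid; grid-mono; greatest-max; below?; top)

-- Linear extensions after adjoining one element

private
  variable
    n : ℕ

mkInverse : ∀ {c₁ ℓ₁ c₂ ℓ₂} {S : Setoid c₁ ℓ₁} {T : Setoid c₂ ℓ₂} →
  let module S = Setoid S
      module T = Setoid T
  in (to : S.Carrier → T.Carrier) (from : T.Carrier → S.Carrier) →
     (∀ {x y} → x S.≈ y → to x T.≈ to y) → (∀ {x y} → x T.≈ y → from x S.≈ from y) →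
     (∀ y → to (from y) T.≈ y) → (∀ x → from (to x) S.≈ x) → Inverse S T
mkInverse {S = S} {T} to from to-cong from-cong toFrom fromTo = record
  { to = to ; from = from ; to-cong = to-cong ; from-cong = from-cong
  ; inverse = strictlyInverseˡ⇒inverseˡ S T to-cong toFrom , strictlyInverseʳ⇒inverseʳ S T from-cong fromTo }

-- One construction for two uses: with nothing above the new element `zero` it enlarges posets, and
-- with complementary `D` and `U` it inserts `zero` into a chain.
Adjoin : Rel (Fin n) 0ℓ → Pred (Fin n) 0ℓ → Pred (Fin n) 0ℓ → Rel (Fin (suc n)) 0ℓ
Adjoin R D U zero    zero    = ⊤
Adjoin R D U zero    (suc j) = U j
Adjoin R D U (suc i) zero    = D i
Adjoin R D U (suc i) (suc j) = R i j

-- The first three fields are the instances of transitivity that involve the new element; the last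
-- one is antisymmetry against it.
record IsCut {n} (R : Rel (Fin n) 0ℓ) (D U : Pred (Fin n) 0ℓ) : Set where
  field
    down     : ∀ {i j} → R i j → D j → D i
    up       : ∀ {i j} → U i → R i j → U j
    across   : ∀ {i j} → D i → U j → R i j
    disjoint : ∀ {i} → D i → ¬ U i

module _ {R : Rel (Fin n) 0ℓ} {D U : Pred (Fin n) 0ℓ} (cut : IsCut R D U) where
  open IsCut cut

  adjoin-isPartialOrder : IsPartialOrder _≡_ R → IsPartialOrder _≡_ (Adjoin R D U)
  adjoin-isPartialOrder po = record
    { isPreorder = record
      { isEquivalence = isEquivalence
      ; reflexive = λ { {i} refl → rfl i }
      ; trans = λ {i} {j} {k} → trns i j k }
    ; antisym = λ {i} {j} → asym i j }
    where
    module po = IsPartialOrder po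
    rfl : ∀ i → Adjoin R D U i i
    rfl zero    = tt
    rfl (suc i) = po.refl
    trns : ∀ i j k → Adjoin R D U i j → Adjoin R D U j k → Adjoin R D U i k
    trns zero    zero    k       _ q = q
    trns zero    (suc j) zero    _ _ = tt
    trns zero    (suc j) (suc k) p q = up p q
    trns (suc i) zero    zero    p _ = p
    trns (suc i) zero    (suc k) p q = across p q
    trns (suc i) (suc j) zero    p q = down p q
    trns (suc i) (suc j) (suc k) p q = po.trans p q
    asym : ∀ i j → Adjoin R D U i j → Adjoin R D U j i → i ≡ j
    asym zero    zero    _ _ = refl
    asym zero    (suc j) p q = contradiction p (disjoint q)
    asym (suc i) zero    p q = contradiction q (disjoint p)
    asym (suc i) (suc j) p q = cong suc (po.antisym p q)

  adjoin-isTotalOrder : (∀ i → D i ⊎ U i) → IsTotalOrder _≡_ R → IsTotalOrder _≡_ (Adjoin R D U)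
  adjoin-isTotalOrder D⊎U to = record { isPartialOrder = adjoin-isPartialOrder to.isPartialOrder ; total = ttl }
    where
    module to = IsTotalOrder to
    ttl : ∀ i j → Adjoin R D U i j ⊎ Adjoin R D U j i
    ttl zero    zero    = inj₁ tt
    ttl zero    (suc j) with D⊎U j
    ... | inj₁ d = inj₂ d
    ... | inj₂ u = inj₁ u
    ttl (suc i) zero    = D⊎U i
    ttl (suc i) (suc j) = to.total i j

module _ (P : FinPoset n) where
  open FinPoset P

  adjoinPoset : (D : Pred (Fin n) 0ℓ) → Decidable D → (∀ {i j} → i ≼ j → D j → D i) → FinPoset (suc n)
  adjoinPoset D D? down = record
    { _≼_ = Adjoin _≼_ D ∅
    ; isDecPartialOrder = record
      { isPartialOrder = adjoin-isPartialOrder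
          (record { down = down ; up = λ () ; across = λ _ () ; disjoint = λ _ () }) Po.isPartialOrder
      ; _≟_ = _≟ᶠ_
      ; _≤?_ = dec }
    }
    where
    module Po = IsDecPartialOrder isDecPartialOrder
    dec : ∀ i j → Dec (Adjoin _≼_ D ∅ i j)
    dec zero    zero    = yes tt
    dec zero    (suc j) = no id
    dec (suc i) zero    = D? i
    dec (suc i) (suc j) = i Po.≤? j

module _ {n} {P : FinPoset n} where

  module _ (L : LinearExtension P) where
    open LinearExtension L

    Last : Fin n → Set
    Last x = ∀ i → i ⊑ x

  -- Pulling the equality back along the first projection makes the proof of being last irrelevant,
  -- so each order is still counted once.
  topExtensions : Fin n → Setoid _ _
  topExtensions x = on-setoid (linearExtensions P) (proj₁ {B = λ L → Last L x})

module Adjoined {n} (P : FinPoset n) (D : Pred (Fin n) 0ℓ) (D? : Decidable D)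
  (down : ∀ {i j} → FinPoset._≼_ P i j → D j → D i) where

  P⁺ : FinPoset (suc n)
  P⁺ = adjoinPoset P D D? down

  restrict : LinearExtension P⁺ → LinearExtension P
  restrict L = record
    { _⊑_ = λ i j → suc i ⊑ suc j
    ; isTotalOrder = record
      { isPartialOrder = record
        { isPreorder = record
          { isEquivalence = isEquivalence ; reflexive = λ { refl → O.refl } ; trans = O.trans }
        ; antisym = λ p q → suc-injective (O.antisym p q) }
      ; total = λ i j → O.total (suc i) (suc j) }
    ; extends = extends }
    where
    open LinearExtension L
    module O = IsTotalOrder isTotalOrder

  addLast : LinearExtension P → LinearExtension P⁺
  addLast L = record
    { _⊑_ = Adjoin _⊑_ U ∅
    ; isTotalOrder = adjoin-isTotalOrder
        (record { down = λ _ _ → tt ; up = λ () ; across = λ _ () ; disjoint = λ _ () }) (λ _ → inj₁ tt) isTotalOrder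
    ; extends = λ {i} {j} → ex i j }
    where
    open LinearExtension L
    ex : ∀ i j → FinPoset._≼_ P⁺ i j → Adjoin _⊑_ U ∅ i j
    ex zero    zero    _ = tt
    ex (suc i) zero    _ = tt
    ex (suc i) (suc j) p = extends p

  -- Whatever `D` is, placing the new element last leaves exactly the order of the old elements
  -- free.
  new-last : Inverse (linearExtensions P) (topExtensions {P = P⁺} zero)
  new-last = mkInverse
    (λ L → addLast L , λ { zero → tt ; (suc i) → tt })
    (restrict ∘ proj₁)
    (λ { e zero zero → ⇔-id _ ; e zero (suc j) → ⇔-id _ ; e (suc i) zero → ⇔-id _ ; e (suc i) (suc j) → e i j })
    (λ e i j → e (suc i) (suc j))
    toFrom
    (λ L i j → ⇔-id _)
    where
    toFrom : ∀ ((L , _) : Setoid.Carrier (topExtensions {P = P⁺} zero)) → ∀ i j →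
      LinearExtension._⊑_ (addLast (restrict L)) i j ⇔ LinearExtension._⊑_ L i j
    toFrom (L , last) zero    zero    = mk⇔ (λ _ → last zero) (λ _ → tt)
    toFrom (L , last) zero    (suc j) = mk⇔ (λ ())
      (λ p → contradiction (IsTotalOrder.antisym (LinearExtension.isTotalOrder L) p (last (suc j))) λ ())
    toFrom (L , last) (suc i) zero    = mk⇔ (λ _ → last (suc i)) (λ _ → tt)
    toFrom (L , last) (suc i) (suc j) = ⇔-id _

module AdjoinedAbove {n} (P : FinPoset n) where

  open Adjoined P U (λ _ → yes tt) (λ _ _ → tt) public

  new-always-last : Inverse (topExtensions {P = P⁺} zero) (linearExtensions P⁺)
  new-always-last = mkInverse proj₁
    (λ L → L , λ { zero → IsTotalOrder.refl (LinearExtension.isTotalOrder L) ; (suc i) → LinearExtension.extends L tt })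
    id id (λ L i j → ⇔-id _) (λ L i j → ⇔-id _)

Maximal : FinPoset n → Fin n → Set
Maximal P x = ∀ {j} → x ≼ j → j ≡ x
  where open FinPoset P

module AdjoinedBeside {n} (P : FinPoset n) (x : Fin n) (x-max : Maximal P x) where

  ≢x-down : ∀ {i j} → FinPoset._≼_ P i j → j ≢ x → i ≢ x
  ≢x-down p j≢x refl = j≢x (x-max p)

  open Adjoined P (_≢ x) (λ i → ¬? (i ≟ᶠ x)) ≢x-down public

  addPenultimate : (L : LinearExtension P) → Last L x → LinearExtension P⁺
  addPenultimate L last = record
    { _⊑_ = Adjoin _⊑_ (_≢ x) (_≡ x)
    ; isTotalOrder = adjoin-isTotalOrder
        (record { down = λ { {j = j} p j≢x refl → j≢x (O.antisym (last j) p) }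
                ; up = λ { {j = j} refl p → O.antisym (last j) p }
                ; across = λ { {i} _ refl → last i }
                ; disjoint = id })
        x-dec isTotalOrder
    ; extends = λ {i} {j} → ex i j }
    where
    open LinearExtension L
    module O = IsTotalOrder isTotalOrder
    x-dec : ∀ i → i ≢ x ⊎ i ≡ x
    x-dec i with i ≟ᶠ x
    ... | yes i≡x = inj₂ i≡x
    ... | no  i≢x = inj₁ i≢x
    ex : ∀ i j → FinPoset._≼_ P⁺ i j → Adjoin _⊑_ (_≢ x) (_≡ x) i j
    ex zero    zero    _ = tt
    ex (suc i) zero    p = p
    ex (suc i) (suc j) p = extends p

  -- Every old element except `x` lies below the new one, so in an extension ending with `x` the new
  -- element is forced into the penultimate place.
  old-last : Inverse (topExtensions {P = P} x) (topExtensions {P = P⁺} (suc x))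
  old-last = mkInverse
    (λ (L , last) → addPenultimate L last , λ { zero → refl ; (suc i) → last i })
    (λ (L , last) → restrict L , last ∘ suc)
    (λ { e zero zero → ⇔-id _ ; e zero (suc j) → ⇔-id _ ; e (suc i) zero → ⇔-id _ ; e (suc i) (suc j) → e i j })
    (λ e i j → e (suc i) (suc j))
    toFrom
    (λ L i j → ⇔-id _)
    where
    toFrom : ∀ ((L , last) : Setoid.Carrier (topExtensions {P = P⁺} (suc x))) → ∀ i j →
      LinearExtension._⊑_ (addPenultimate (restrict L) (last ∘ suc)) i j ⇔ LinearExtension._⊑_ L i j
    toFrom (L , last) = go
      where
      open LinearExtension L
      module O = IsTotalOrder isTotalOrder
      go : ∀ i j → Adjoin (λ i j → suc i ⊑ suc j) (_≢ x) (_≡ x) i j ⇔ i ⊑ j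
      go zero    zero    = mk⇔ (λ _ → O.refl) (λ _ → tt)
      go zero    (suc j) = mk⇔ (λ { refl → last zero }) back
        where
        back : zero ⊑ suc j → j ≡ x
        back p with j ≟ᶠ x
        ... | yes j≡x = j≡x
        ... | no  j≢x = contradiction (O.antisym p (extends j≢x)) λ ()
      go (suc i) zero    = mk⇔ extends λ { p refl → contradiction (O.antisym p (last zero)) λ () }
      go (suc i) (suc j) = ⇔-id _

  -- The greater of `zero` and `suc x` dominates all the rest, so comparing these two decides which
  -- one is last.
  new-or-old-last : Inverse (topExtensions {P = P⁺} zero ⊎ₛ topExtensions {P = P⁺} (suc x)) (linearExtensions P⁺)
  new-or-old-last = mkInverse
    forget
    split
    (λ { (inj₁ e) → e ; (inj₂ e) → e })
    (λ {L} {M} → split-cong L M)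
    (λ L → forget-splitBy L (IsTotalOrder.total (LinearExtension.isTotalOrder L) (suc x) zero))
    fromTo
    where
    Split : Setoid _ _
    Split = topExtensions {P = P⁺} zero ⊎ₛ topExtensions {P = P⁺} (suc x)

    forget : Setoid.Carrier Split → LinearExtension P⁺
    forget (inj₁ (L , _)) = L
    forget (inj₂ (L , _)) = L

    -- The comparison is an argument because equal extensions may carry different proofs of
    -- totality; `splitBy-cong` treats them as independent.
    splitBy : ∀ L → LinearExtension._⊑_ L (suc x) zero ⊎ LinearExtension._⊑_ L zero (suc x) → Setoid.Carrier Split
    splitBy L (inj₁ p) = inj₁ (L , λ { zero → O.refl ; (suc i) → go i })
      where
      open LinearExtension L
      module O = IsTotalOrder isTotalOrder
      go : ∀ i → suc i ⊑ zero
      go i with i ≟ᶠ x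
      ... | yes refl = p
      ... | no  i≢x  = extends i≢x
    splitBy L (inj₂ p) = inj₂ (L , λ { zero → p ; (suc i) → go i })
      where
      open LinearExtension L
      module O = IsTotalOrder isTotalOrder
      go : ∀ i → suc i ⊑ suc x
      go i with i ≟ᶠ x
      ... | yes refl = O.refl
      ... | no  i≢x  = O.trans (extends i≢x) p

    split : LinearExtension P⁺ → Setoid.Carrier Split
    split L = splitBy L (IsTotalOrder.total (LinearExtension.isTotalOrder L) (suc x) zero)

    exclusive : ∀ L → LinearExtension._⊑_ L (suc x) zero → ¬ LinearExtension._⊑_ L zero (suc x)
    exclusive L p q with () ← IsTotalOrder.antisym (LinearExtension.isTotalOrder L) p q

    splitBy-cong : ∀ L M s t → Setoid._≈_ (linearExtensions P⁺) L M → Setoid._≈_ Split (splitBy L s) (splitBy M t)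
    splitBy-cong L M (inj₁ p) (inj₁ q) e = inj₁ e
    splitBy-cong L M (inj₁ p) (inj₂ q) e = contradiction (Equivalence.from (e _ _) q) (exclusive L p)
    splitBy-cong L M (inj₂ p) (inj₁ q) e = contradiction (Equivalence.to (e _ _) p) (exclusive M q)
    splitBy-cong L M (inj₂ p) (inj₂ q) e = inj₂ e

    split-cong : ∀ L M → Setoid._≈_ (linearExtensions P⁺) L M → Setoid._≈_ Split (split L) (split M)
    split-cong L M = splitBy-cong L M _ _

    forget-splitBy : ∀ L s → Setoid._≈_ (linearExtensions P⁺) (forget (splitBy L s)) L
    forget-splitBy L (inj₁ _) = λ i j → ⇔-id _
    forget-splitBy L (inj₂ _) = λ i j → ⇔-id _

    splitBy-zero : ∀ L s last → Setoid._≈_ Split (splitBy L s) (inj₁ (L , last))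
    splitBy-zero L (inj₁ _) last = inj₁ λ i j → ⇔-id _
    splitBy-zero L (inj₂ p) last = contradiction p (exclusive L (last (suc x)))

    splitBy-suc : ∀ L s last → Setoid._≈_ Split (splitBy L s) (inj₂ (L , last))
    splitBy-suc L (inj₁ p) last = contradiction (last zero) (exclusive L p)
    splitBy-suc L (inj₂ _) last = inj₂ λ i j → ⇔-id _

    fromTo : ∀ L → Setoid._≈_ Split (split (forget L)) L
    fromTo (inj₁ (L , last)) = splitBy-zero L _ last
    fromTo (inj₂ (L , last)) = splitBy-suc L _ last

-- Realisable pairs and the backward Euclidean algorithm

record Realises (n a b : ℕ) : Set₁ where
  field
    poset   : FinPoset n
    x       : Fin n
    x-max   : Maximal poset x
    all-ext : ext poset ≐ a
    top-ext : Inverse (setoid (Fin b)) (topExtensions {P = poset} x)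

addTop : ∀ {a} → LE n a → Realises (suc n) a a
addTop (P , e) = record
  { poset   = P⁺
  ; x       = zero
  ; x-max   = λ { {zero} _ → refl ; {suc j} () }
  ; all-ext = inverse tops new-always-last
  ; top-ext = tops }
  where
  open AdjoinedAbove P
  tops : Inverse (setoid (Fin _)) (topExtensions {P = P⁺} zero)
  tops = inverse e new-last

realises⇒LE : ∀ {a b} → Realises n a b → LE n a
realises⇒LE R = Realises.poset R , Realises.all-ext R

module Beside {a b} (R : Realises n a b) where
  open Realises R
  open AdjoinedBeside poset x x-max public

  sum-ext : ext P⁺ ≐ (a + b)
  sum-ext = inverse (inverse (inverse (+↔⊎ {a} {b}) (inverse-sym (Pointwise-≡↔≡ (Fin a) (Fin b))))
    (inverse all-ext new-last ⊎-inverse inverse top-ext old-last)) new-or-old-last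

  -- The new element and `x` are incomparable and both maximal, so either can be marked; the two
  -- choices are the two kinds of step of the algorithm.
  markNew : Realises (suc n) (a + b) a
  markNew = record { poset = P⁺ ; x = zero ; x-max = λ { {zero} _ → refl ; {suc j} () }
    ; all-ext = sum-ext ; top-ext = inverse all-ext new-last }

  markOld : Realises (suc n) (a + b) b
  markOld = record { poset = P⁺ ; x = suc x
    ; x-max = λ { {zero} p → contradiction refl p ; {suc j} p → cong suc (x-max p) }
    ; all-ext = sum-ext ; top-ext = inverse top-ext old-last }

emptyPoset : FinPoset 0
emptyPoset = record
  { _≼_ = λ _ _ → ⊤
  ; isDecPartialOrder = record
    { isPartialOrder = record
      { isPreorder = record { isEquivalence = isEquivalence ; reflexive = λ _ → tt ; trans = λ _ _ → tt }
      ; antisym = λ { {()} } }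
    ; _≟_ = _≟ᶠ_
    ; _≤?_ = λ () } }

1∈LE[0] : LE 0 1
1∈LE[0] = emptyPoset , mkInverse (λ _ → L) (λ _ → zero) (λ _ ()) (λ _ → refl) (λ _ ()) (λ { zero → refl })
  where
  L : LinearExtension emptyPoset
  L = record
    { _⊑_ = λ _ _ → ⊤
    ; isTotalOrder = record
      { isPartialOrder = IsDecPartialOrder.isPartialOrder (FinPoset.isDecPartialOrder emptyPoset)
      ; total = λ () }
    ; extends = λ _ → tt }

-- The subtractive Euclidean algorithm run backwards from (1 , 1), indexed by its number of steps.
data SB : ℕ → ℕ → ℕ → Set where
  root  : SB 0 1 1
  new   : ∀ {t a b} → SB t a b → SB (suc t) (a + b) a
  old   : ∀ {t a b} → SB t a b → SB (suc t) (a + b) b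

-- Each step is linear in the pair, so starting at (g , g) instead of (1 , 1) multiplies everything
-- by `g`. The extra `suc` pays for the top element that creates (g , g).
SB⇒realises : ∀ {g t a b} → LE n g → SB t a b → Realises (suc (t + n)) (g * a) (g * b)
SB⇒realises {g = g} l root rewrite *-identityʳ g = addTop l
SB⇒realises {g = g} l (new {a = a} {b} s) rewrite *-distribˡ-+ g a b = Beside.markNew (SB⇒realises l s)
SB⇒realises {g = g} l (old {a = a} {b} s) rewrite *-distribˡ-+ g a b = Beside.markOld (SB⇒realises l s)

-- Finite sums

∑ : ℕ → (ℕ → ℕ) → ℕ
∑ zero    f = 0
∑ (suc n) f = ∑ n f + f n

∑-mono : ∀ n {f g : ℕ → ℕ} → (∀ {i} → i < n → f i ≤ g i) → ∑ n f ≤ ∑ n g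
∑-mono zero    h = z≤n
∑-mono (suc n) h = +-mono-≤ (∑-mono n λ i<n → h (m<n⇒m<1+n i<n)) (h ≤-refl)

∑-const : ∀ n c → ∑ n (λ _ → c) ≡ n * c
∑-const zero    c = refl
∑-const (suc n) c = trans (cong (_+ c) (∑-const n c)) (+-comm (n * c) c)

∑-+ : ∀ n f g → ∑ n (λ i → f i + g i) ≡ ∑ n f + ∑ n g
∑-+ zero    f g = refl
∑-+ (suc n) f g = trans (cong (_+ (f n + g n)) (∑-+ n f g)) (+-interchange (∑ n f) (∑ n g) (f n) (g n))
  where
  +-interchange : ∀ a b c d → a + b + (c + d) ≡ a + c + (b + d)
  +-interchange = solve-∀

∑-*ʳ : ∀ n f c → ∑ n (λ i → f i * c) ≡ ∑ n f * c
∑-*ʳ zero    f c = refl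
∑-*ʳ (suc n) f c = trans (cong (_+ f n * c) (∑-*ʳ n f c)) (sym (*-distribʳ-+ c (∑ n f) (f n)))

∑-swap : ∀ m n (f : ℕ → ℕ → ℕ) → ∑ m (λ i → ∑ n (f i)) ≡ ∑ n (λ j → ∑ m λ i → f i j)
∑-swap zero    n f = sym (trans (∑-const n 0) (*-zeroʳ n))
∑-swap (suc m) n f = trans (cong (_+ ∑ n (f m)) (∑-swap m n f)) (sym (∑-+ n (λ j → ∑ m λ i → f i j) (f m)))

∑-append : ∀ m n f → ∑ (m + n) f ≡ ∑ m f + ∑ n (λ i → f (m + i))
∑-append m zero    f rewrite +-identityʳ m = sym (+-identityʳ (∑ m f))
∑-append m (suc n) f rewrite +-suc m n | ∑-append m n f = +-assoc (∑ m f) _ _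

∑-monoˡ : ∀ {m n} f → m ≤ n → ∑ m f ≤ ∑ n f
∑-monoˡ {m} {n} f m≤n = begin
  ∑ m f            ≤⟨ m≤m+n (∑ m f) _ ⟩
  ∑ m f + _        ≡⟨ sym (∑-append m (n ∸ m) f) ⟩
  ∑ (m + (n ∸ m)) f ≡⟨ cong (λ z → ∑ z f) (m+[n∸m]≡n m≤n) ⟩
  ∑ n f            ∎
  where open ≤-Reasoning

term≤∑ : ∀ {i n} f → i < n → f i ≤ ∑ n f
term≤∑ {i} f i<n = ≤-trans (m≤n+m (f i) (∑ i f)) (∑-monoˡ f i<n)

pigeonhole : ∀ n {z} f → ∑ n f < n * z → ∃[ i ] i < n × f i < z
pigeonhole (suc n) {z} f h with f n <? z
... | yes fn<z = n , ≤-refl , fn<z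
... | no  fn≮z =
  let i , i<n , fi<z = pigeonhole n f (+-cancelʳ-< z (∑ n f) (n * z)
                         (≤-<-trans (+-monoʳ-≤ (∑ n f) (≮⇒≥ fn≮z)) (subst (∑ n f + f n <_) (+-comm z (n * z)) h)))
  in i , m<n⇒m<1+n i<n , fi<z

𝟙 : ∀ {P : Set} → Dec P → ℕ
𝟙 (yes _) = 1
𝟙 (no  _) = 0

𝟙-yes : ∀ {P : Set} (P? : Dec P) → P → 1 ≤ 𝟙 P?
𝟙-yes (yes _)  p = ≤-refl
𝟙-yes (no ¬p)  p = contradiction p ¬p

∑-none : ∀ n {P : Pred ℕ _} (P? : Decidable P) → (∀ {i} → i < n → ¬ P i) → ∑ n (λ i → 𝟙 (P? i)) ≡ 0
∑-none zero    P? h = refl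
∑-none (suc n) P? h with P? n
... | yes p = contradiction p (h ≤-refl)
... | no  _ = trans (+-identityʳ _) (∑-none n P? λ i<n → h (m<n⇒m<1+n i<n))

∑-unique : ∀ n {P : Pred ℕ _} (P? : Decidable P) → (∀ {i j} → i < n → j < n → P i → P j → i ≡ j) →
  ∑ n (λ i → 𝟙 (P? i)) ≤ 1
∑-unique zero    P? h = z≤n
∑-unique (suc n) P? h with P? n
... | yes p = ≤-reflexive (cong (_+ 1) (∑-none n P? λ i<n q → <⇒≢ i<n (h (m<n⇒m<1+n i<n) ≤-refl q p)))
... | no  _ = subst (_≤ 1) (sym (+-identityʳ _)) (∑-unique n P? λ i<n j<n → h (m<n⇒m<1+n i<n) (m<n⇒m<1+n j<n))

-- If the last index counts, the trivial bound `suc n` is already at most p / c; if not, it drops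
-- out of the sum.
count-multiples : ∀ n c p .{{_ : NonZero c}} → ∑ n (λ i → 𝟙 (c * suc i ≤? p)) ≤ p / c
count-multiples zero    c p = z≤n
count-multiples (suc n) c p with c * suc n ≤? p
... | no  _ = subst (_≤ p / c) (sym (+-identityʳ _)) (count-multiples n c p)
... | yes h = begin
  ∑ n (λ i → 𝟙 (c * suc i ≤? p)) + 1  ≤⟨ +-monoˡ-≤ 1 (∑-mono n λ {i} _ → 𝟙≤1 (c * suc i ≤? p)) ⟩
  ∑ n (λ _ → 1) + 1                   ≡⟨ cong (_+ 1) (trans (∑-const n 1) (*-identityʳ n)) ⟩
  n + 1                               ≡⟨ +-comm n 1 ⟩
  suc n                               ≡⟨ sym (m*n/n≡m (suc n) c) ⟩
  suc n * c / c                       ≤⟨ /-monoˡ-≤ c (subst (_≤ p) (*-comm c (suc n)) h) ⟩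
  p / c                               ∎
  where
  open ≤-Reasoning
  𝟙≤1 : ∀ {P : Set} (P? : Dec P) → 𝟙 P? ≤ 1
  𝟙≤1 (yes _) = ≤-refl
  𝟙≤1 (no  _) = z≤n

-- Doubling the range adds 2 ^ e terms, each at most N / 2 ^ e, so every dyadic block costs at most
-- `N`.
∑-harmonic : ∀ N e → ∑ (2 ^ e) (λ i → N / suc i) ≤ N * suc e
∑-harmonic N zero    = ≤-reflexive (trans (n/1≡n N) (sym (*-identityʳ N)))
∑-harmonic N (suc e) = begin
  ∑ (2 ^ e + (2 ^ e + 0)) f               ≡⟨ cong (λ z → ∑ (2 ^ e + z) f) (+-identityʳ (2 ^ e)) ⟩
  ∑ (2 ^ e + 2 ^ e) f                     ≡⟨ ∑-append (2 ^ e) (2 ^ e) f ⟩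
  ∑ (2 ^ e) f + ∑ (2 ^ e) (λ i → f (2 ^ e + i))  ≤⟨ +-mono-≤ (∑-harmonic N e) second ⟩
  N * suc e + N                           ≡⟨ trans (+-comm (N * suc e) N) (sym (*-suc N (suc e))) ⟩
  N * suc (suc e)                         ∎
  where
  open ≤-Reasoning
  f : ℕ → ℕ
  f i = N / suc i
  instance
    2^e≢0 : NonZero (2 ^ e)
    2^e≢0 = m^n≢0 2 e
  second : ∑ (2 ^ e) (λ i → f (2 ^ e + i)) ≤ N
  second = begin
    ∑ (2 ^ e) (λ i → f (2 ^ e + i))   ≤⟨ ∑-mono (2 ^ e) (λ {i} _ → /-monoʳ-≤ N (m≤n⇒m≤1+n (m≤m+n (2 ^ e) i))) ⟩
    ∑ (2 ^ e) (λ _ → N / 2 ^ e)       ≡⟨ ∑-const (2 ^ e) _ ⟩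
    2 ^ e * (N / 2 ^ e)               ≡⟨ *-comm (2 ^ e) (N / 2 ^ e) ⟩
    N / 2 ^ e * 2 ^ e                 ≤⟨ m/n*n≤m N (2 ^ e) ⟩
    N                                 ∎

-- A short Euclidean algorithm for every prime

SB-old : ∀ k {t a b} → SB t a b → SB (k + t) (k * b + a) b
SB-old zero    s = s
SB-old (suc k) {t} {a} {b} s = subst (λ z → SB (suc k + t) z b) (shuffle b (k * b) a) (old (SB-old k s))
  where
  shuffle : ∀ b c a → c + a + b ≡ b + c + a
  shuffle = solve-∀

module Modulus (N : ℕ) (p-prime : Prime (suc N)) where
  open ≤-Reasoning

  p : ℕ
  p = suc N

  hit⁺ : ∀ q r m → Dec (q * m % p ≡ r)
  hit⁺ q r m = q * m % p ≟ r

  hit⁻ : ∀ q r m → Dec (p ∣ q * m + r)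
  hit⁻ q r m = p ∣? q * m + r

  -- For r < p, the number of signs with q m ≡ ± r modulo `p`; the minus sign is expressed by
  -- divisibility to stay in the naturals.
  hit : ℕ → ℕ → ℕ → ℕ
  hit q r m = 𝟙 (hit⁺ q r m) + 𝟙 (hit⁻ q r m)

  ∣<⇒≡0 : ∀ {d} → p ∣ d → d < p → d ≡ 0
  ∣<⇒≡0 {zero}  _   _   = refl
  ∣<⇒≡0 {suc d} p∣d d<p = contradiction (∣⇒≤ p∣d) (<⇒≱ d<p)

  -- Truncated subtraction gives one inequality; exchanging `m` and `m′` gives the other, and hence
  -- injectivity of multiplication by `q` modulo `p`.
  cancel : ∀ {q m m′} → 0 < q → q < p → m′ < p → p ∣ q * m′ ∸ q * m → m′ ≤ m
  cancel {q} {m} {m′} 0<q q<p m′<p p∣ with euclidsLemma q (m′ ∸ m) p-prime (subst (p ∣_) (sym (*-distribˡ-∸ q m′ m)) p∣)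
  ... | inj₁ p∣q = contradiction (∣<⇒≡0 p∣q q<p) (m<n⇒n≢0 0<q)
  ... | inj₂ p∣d = m∸n≡0⇒m≤n (∣<⇒≡0 p∣d (≤-<-trans (m∸n≤m m′ m) m′<p))

  %≡%⇒∣∸ : ∀ a b → a % p ≡ b % p → p ∣ a ∸ b
  %≡%⇒∣∸ a b e = divides (a / p ∸ b / p) (begin-equality
    a ∸ b                                          ≡⟨ cong₂ _∸_ (m≡m%n+[m/n]*n a p) (m≡m%n+[m/n]*n b p) ⟩
    (a % p + a / p * p) ∸ (b % p + b / p * p)      ≡⟨ cong (λ z → (z + a / p * p) ∸ (b % p + b / p * p)) e ⟩
    (b % p + a / p * p) ∸ (b % p + b / p * p)      ≡⟨ [m+n]∸[m+o]≡n∸o (b % p) _ _ ⟩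
    a / p * p ∸ b / p * p                          ≡⟨ sym (*-distribʳ-∸ p (a / p) (b / p)) ⟩
    (a / p ∸ b / p) * p                            ∎)

  ∣+∣+⇒∣∸ : ∀ a b r → p ∣ a + r → p ∣ b + r → p ∣ a ∸ b
  ∣+∣+⇒∣∸ a b r (divides h e) (divides k f) = divides (h ∸ k) (begin-equality
    a ∸ b                  ≡⟨ sym ([m+n]∸[m+o]≡n∸o r a b) ⟩
    (r + a) ∸ (r + b)      ≡⟨ cong₂ _∸_ (trans (+-comm r a) e) (trans (+-comm r b) f) ⟩
    h * p ∸ k * p          ≡⟨ sym (*-distribʳ-∸ p h k) ⟩
    (h ∸ k) * p            ∎)

  -- As `p` is prime, `q` is invertible, so each of the two signs determines at most one residue m.
  ∑-hit : ∀ {q} r → 0 < q → q < p → ∑ N (λ i → hit q r (suc i)) ≤ 2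
  ∑-hit {q} r 0<q q<p = begin
    ∑ N (λ i → hit q r (suc i))
      ≡⟨ ∑-+ N (λ i → 𝟙 (hit⁺ q r (suc i))) (λ i → 𝟙 (hit⁻ q r (suc i))) ⟩
    ∑ N (λ i → 𝟙 (hit⁺ q r (suc i))) + ∑ N (λ i → 𝟙 (hit⁻ q r (suc i)))
      ≤⟨ +-mono-≤
           (∑-unique N (λ i → hit⁺ q r (suc i)) λ {i} {j} i<N j<N e f → ℕ.suc-injective (≤-antisym
             (cancel 0<q q<p (s≤s i<N) (%≡%⇒∣∸ (q * suc i) (q * suc j) (trans e (sym f))))
             (cancel 0<q q<p (s≤s j<N) (%≡%⇒∣∸ (q * suc j) (q * suc i) (trans f (sym e))))))
           (∑-unique N (λ i → hit⁻ q r (suc i)) λ {i} {j} i<N j<N e f → ℕ.suc-injective (≤-antisym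
             (cancel 0<q q<p (s≤s i<N) (∣+∣+⇒∣∸ _ (q * suc j) r e f))
             (cancel 0<q q<p (s≤s j<N) (∣+∣+⇒∣∸ _ (q * suc i) r f e)))) ⟩
    2 ∎

  module Euclid (u : ℕ → ℕ → ℕ) (Z : ℕ)
    (u-spec : ∀ q r a → a * (q * r) ≤ p → a ≤ u q r ⊎ Z ≤ u q r) (l : ℕ) where

    m : ℕ
    m = suc l

    -- The charge to the remainder `suc x` adds the weights of all q with q m ≡ ± suc x, not only of
    -- the continuant that the algorithm meets. This makes it an explicit function of `m`, which can
    -- be averaged.
    v : ℕ → ℕ
    v x = ∑ N λ y → hit (suc y) (suc x) m * u (suc y) (suc x)

    -- The congruences q m ≡ ± r and q′ m ≡ ∓ r′ modulo p, free of subtraction.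
    Signed : (q r q′ r′ : ℕ) → Set
    Signed q r q′ r′ = (∃[ h ] ∃[ h′ ] q * m ≡ r + h * p × q′ * m + r′ ≡ h′ * p)
                     ⊎ (∃[ h ] ∃[ h′ ] q * m + r ≡ h * p × q′ * m ≡ r′ + h′ * p)

    Signed⇒hit : ∀ {q r q′ r′} → r < p → Signed q r q′ r′ → 1 ≤ hit q r m
    Signed⇒hit {q} {r} r<p (inj₁ (h , _ , e , _)) = ≤-trans
      (𝟙-yes (hit⁺ q r m) (trans (cong (_% p) e) (trans ([m+kn]%n≡m%n r h p) (m<n⇒m%n≡m r<p)))) (m≤m+n _ _)
    Signed⇒hit {q} {r} r<p (inj₂ (h , _ , e , _)) = ≤-trans (𝟙-yes (hit⁻ q r m) (divides h e)) (m≤n+m _ (𝟙 (hit⁺ q r m)))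

    -- From q m ≡ ± r and q′ m ≡ ∓ r′ follows (q′ + a q) m ≡ ∓ (r′ - a r) for the next continuant,
    -- so the signs alternate.
    Signed-step : ∀ {q r q′ r′} a r″ → r′ ≡ r″ + a * r → Signed q r q′ r′ → Signed (q′ + a * q) r″ q r
    Signed-step {q} {r} {q′} {r′} a r″ e (inj₁ (h , h′ , e₁ , e₂)) = inj₂ (h′ + a * h , h , (begin-equality
      (q′ + a * q) * m + r″            ≡⟨ expand q′ a q m r″ ⟩
      q′ * m + a * (q * m) + r″        ≡⟨ cong (λ z → q′ * m + a * z + r″) e₁ ⟩
      q′ * m + a * (r + h * p) + r″    ≡⟨ regroup (q′ * m) a r h p r″ ⟩
      q′ * m + (r″ + a * r) + a * h * p ≡⟨ cong (λ z → q′ * m + z + a * h * p) (sym e) ⟩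
      q′ * m + r′ + a * h * p          ≡⟨ cong (_+ a * h * p) e₂ ⟩
      h′ * p + a * h * p               ≡⟨ sym (*-distribʳ-+ p h′ (a * h)) ⟩
      (h′ + a * h) * p                 ∎) , e₁)
      where
      expand : ∀ q′ a q m r″ → (q′ + a * q) * m + r″ ≡ q′ * m + a * (q * m) + r″
      expand = solve-∀
      regroup : ∀ c a r h p r″ → c + a * (r + h * p) + r″ ≡ c + (r″ + a * r) + a * h * p
      regroup = solve-∀
    Signed-step {q} {r} {q′} {r′} a r″ e (inj₂ (h , h′ , e₁ , e₂)) = inj₁ (h′ + a * h , h ,
      -- Adding a r to both sides makes q m + r appear, for which an equation is known, and avoids
      -- subtraction.
      +-cancelʳ-≡ (a * r) _ _ (begin-equality
        (q′ + a * q) * m + a * r             ≡⟨ expand q′ a q m r ⟩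
        q′ * m + a * (q * m + r)             ≡⟨ cong₂ (λ y z → y + a * z) e₂ e₁ ⟩
        r′ + h′ * p + a * (h * p)            ≡⟨ cong (λ z → z + h′ * p + a * (h * p)) e ⟩
        r″ + a * r + h′ * p + a * (h * p)    ≡⟨ regroup r″ (a * r) h′ p a h ⟩
        r″ + (h′ + a * h) * p + a * r        ∎) , e₁)
      where
      expand : ∀ q′ a q m r → (q′ + a * q) * m + a * r ≡ q′ * m + a * (q * m + r)
      expand = solve-∀
      regroup : ∀ r″ c h′ p a h → r″ + c + h′ * p + a * (h * p) ≡ r″ + (h′ + a * h) * p + c
      regroup = solve-∀

    u≤v : ∀ {y x} → y < N → 1 ≤ hit (suc y) (suc x) m → u (suc y) (suc x) ≤ v x
    u≤v {y} {x} y<N 1≤hit = ≤-trans (m≤n*m _ (hit (suc y) (suc x) m) {{>-nonZero 1≤hit}})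
      (term≤∑ (λ y → hit (suc y) (suc x) m * u (suc y) (suc x)) y<N)

    module _ (small : ∑ N v < Z) where

      -- A weight of at least `Z` would already exceed the whole sum, so only the first alternative
      -- of `u-spec` remains.
      quotient≤v : ∀ {q x} a → 0 < q → q < p → x < N → 1 ≤ hit q (suc x) m → a * (q * suc x) ≤ p → a ≤ v x
      quotient≤v {suc y} {x} a _ (s≤s y<N) x<N 1≤hit h with u-spec (suc y) (suc x) a h
      ... | inj₁ a≤u = ≤-trans a≤u (u≤v y<N 1≤hit)
      ... | inj₂ Z≤u = contradiction (≤-trans Z≤u (≤-trans (u≤v y<N 1≤hit) (term≤∑ v x<N))) (<⇒≱ small)

      -- The remainders strictly decrease, so distinct quotients are charged to distinct terms of ∑ v.
      euclid : ∀ x → Acc _<_ x → ∀ {q q′ r′} → suc x < r′ → 0 < q → q * r′ + q′ * suc x ≡ p →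
        Signed q (suc x) q′ r′ → ∃[ t ] SB t r′ (suc x) × t ≤ ∑ (suc x) v
      euclid x (acc rec) {q} {q′} {r′} r<r′ 0<q inv sgn = go (r′ % r) refl (m≥n⇒m/n>0 (<⇒≤ r<r′))
        where
        r a : ℕ
        r = suc x
        a = r′ / r
        -- The continuant invariant q r′ + q′ r = p yields a q r ≤ q r′ ≤ p, as the weights require,
        -- and also the ranges of `q` and `r`.
        qr′≤p : q * r′ ≤ p
        qr′≤p = subst (q * r′ ≤_) inv (m≤m+n (q * r′) (q′ * r))
        q<p : q < p
        q<p = <-≤-trans (m<m*n q r′ {{>-nonZero 0<q}} (≤-<-trans (s≤s z≤n) r<r′)) qr′≤p
        r<p : r < p
        r<p = <-≤-trans r<r′ (≤-trans (m≤n*m r′ q {{>-nonZero 0<q}}) qr′≤p)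
        x<N : x < N
        x<N = s<s⁻¹ r<p
        aqr≤p : a * (q * r) ≤ p
        aqr≤p = begin
          a * (q * r)  ≡⟨ swap a q r ⟩
          q * (a * r)  ≤⟨ *-monoʳ-≤ q (m/n*n≤m r′ r) ⟩
          q * r′       ≤⟨ qr′≤p ⟩
          p            ∎
          where
          swap : ∀ a q r → a * (q * r) ≡ q * (a * r)
          swap = solve-∀
        a≤v : a ≤ v x
        a≤v = quotient≤v a 0<q q<p x<N (Signed⇒hit {q} {r} {q′} {r′} r<p sgn) aqr≤p
        decompose : ∀ {ρ} → r′ % r ≡ ρ → r′ ≡ ρ + a * r
        decompose refl = m≡m%n+[m/n]*n r′ r
        go : ∀ ρ → r′ % r ≡ ρ → 0 < a → ∃[ t ] SB t r′ r × t ≤ ∑ r v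
        -- If the remainder vanishes, `r` divides both terms of the invariant, hence the prime `p`,
        -- and r < p leaves only r = 1.
        go zero e 0<a with prime⇒irreducible p-prime {r} (subst (r ∣_) inv
                             (∣m∣n⇒∣m+n (∣n⇒∣m*n q (m%n≡0⇒n∣m r′ r e)) (∣n⇒∣m*n q′ (∣-refl {r}))))
        ... | inj₂ r≡p = contradiction r≡p (<⇒≢ r<p)
        -- The pair (a , 1) is reached from the root (1 , 1) in only a - 1 steps.
        ... | inj₁ r≡1 = subst (λ z → ∃[ t ] SB t r′ z × t ≤ ∑ r v) (sym r≡1) (a ∸ 1 ,
          subst₂ (λ t z → SB t z 1) (+-identityʳ (a ∸ 1)) (begin-equality
            (a ∸ 1) * 1 + 1  ≡⟨ cong (_+ 1) (*-identityʳ (a ∸ 1)) ⟩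
            a ∸ 1 + 1        ≡⟨ m∸n+n≡m 0<a ⟩
            a                ≡⟨ sym (*-identityʳ a) ⟩
            a * 1            ≡⟨ cong (a *_) (sym r≡1) ⟩
            a * r            ≡⟨ sym (decompose e) ⟩
            r′               ∎) (SB-old (a ∸ 1) root) ,
          ≤-trans (m∸n≤m a 1) (≤-trans a≤v (m≤n+m (v x) (∑ x v))))
        go (suc x₁) e 0<a =
          let t , s , t≤ = euclid x₁ (rec x₁<x) {q′ + a * q} {q} {r} (s<s x₁<x)
                             (≤-trans (*-mono-≤ 0<a 0<q) (m≤n+m (a * q) q′))
                             (trans (trans (regroup q′ a q r (suc x₁)) (cong (λ z → q * z + q′ * r) (sym (decompose e)))) inv)
                             (Signed-step {q} {r} {q′} {r′} a (suc x₁) (decompose e) sgn)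
          -- One `new` step exchanges the roles of the two numbers and undoes one subtraction; the a
          -- - 1 others keep `r` fixed. So the division costs `a` steps.
          in (a ∸ 1) + suc t ,
             subst (λ z → SB ((a ∸ 1) + suc t) z r) (begin-equality
               (a ∸ 1) * r + (r + suc x₁)      ≡⟨ collect (a ∸ 1) r (suc x₁) ⟩
               suc x₁ + (a ∸ 1 + 1) * r        ≡⟨ cong (λ z → suc x₁ + z * r) (m∸n+n≡m 0<a) ⟩
               suc x₁ + a * r                  ≡⟨ sym (decompose e) ⟩
               r′                              ∎) (SB-old (a ∸ 1) (new s)) ,
             (begin
               a ∸ 1 + suc t                   ≡⟨ sym (+-assoc (a ∸ 1) 1 t) ⟩
               a ∸ 1 + 1 + t                   ≡⟨ cong (_+ t) (m∸n+n≡m 0<a) ⟩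
               a + t                           ≤⟨ +-mono-≤ a≤v (≤-trans t≤ (∑-monoˡ v x₁<x)) ⟩
               v x + ∑ x v                     ≡⟨ +-comm (v x) (∑ x v) ⟩
               ∑ x v + v x                     ∎)
          where
          x₁<x : x₁ < x
          x₁<x = s<s⁻¹ (subst (_< r) e (m%n<n r′ r))
          regroup : ∀ q′ a q r ρ → (q′ + a * q) * r + q * ρ ≡ q * (ρ + a * r) + q′ * r
          regroup = solve-∀
          collect : ∀ b r ρ → b * r + (r + ρ) ≡ ρ + (b + 1) * r
          collect = solve-∀

      shortPath : l < N → ∃[ t ] SB t p m × t < Z
      shortPath l<N =
        -- The start has continuants 1 and 0, with 1 m ≡ m and 0 m ≡ - p.
        let t , s , t≤ = euclid l (<-wellFounded l) {1} {0} {p} (s<s l<N) ≤-refl (simplify p)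
              (inj₁ (0 , 1 , refl , sym (+-identityʳ p)))
        in t , s , ≤-<-trans t≤ (≤-<-trans (∑-monoˡ v l<N) small)
        where
        simplify : ∀ p → 1 * p + 0 ≡ p
        simplify = solve-∀

  -- Averaging the weights over all residues

  module Weights (e s : ℕ) (N≤2^e : N ≤ 2 ^ e) (8+8e≤2^s : 8 * suc e ≤ 2 ^ s) where

    T Z : ℕ
    T = 2 ^ s
    Z = suc (8 * suc e * suc s)

    instance
      T≢0 : NonZero T
      T≢0 = m^n≢0 2 s

    -- A quotient a at the pair (q , r) satisfies a q r ≤ p: quotients below T are paid for exactly, and the
    -- others by the prohibitive price Z.
    u : ℕ → ℕ → ℕ
    u q r = ∑ T (λ t → 𝟙 (suc t * (q * r) ≤? p)) + 𝟙 (T * (q * r) ≤? p) * Z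

    u-spec : ∀ q r a → a * (q * r) ≤ p → a ≤ u q r ⊎ Z ≤ u q r
    u-spec q r a h with T ≤? a
    ... | yes T≤a = inj₂ (≤-trans
      (m≤n*m Z (𝟙 (T * (q * r) ≤? p)) {{>-nonZero (𝟙-yes (T * (q * r) ≤? p) (≤-trans (*-monoˡ-≤ (q * r) T≤a) h))}})
      (m≤n+m _ (∑ T λ t → 𝟙 (suc t * (q * r) ≤? p))))
    ... | no  T≰a = inj₁ (begin
      a                                        ≡⟨ sym (trans (∑-const a 1) (*-identityʳ a)) ⟩
      ∑ a (λ _ → 1)                            ≤⟨ ∑-mono a (λ {t} t<a → 𝟙-yes (suc t * (q * r) ≤? p) (≤-trans (*-monoˡ-≤ (q * r) t<a) h)) ⟩
      ∑ a (λ t → 𝟙 (suc t * (q * r) ≤? p))     ≤⟨ ∑-monoˡ _ (<⇒≤ (≰⇒> T≰a)) ⟩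
      ∑ T (λ t → 𝟙 (suc t * (q * r) ≤? p))     ≤⟨ m≤m+n _ _ ⟩
      u q r                                    ∎)

    ∑∑ : (ℕ → ℕ → ℕ) → ℕ
    ∑∑ f = ∑ N λ x → ∑ N λ y → f (suc y) (suc x)

    ∑-harmonic′ : ∀ M → ∑ N (λ x → M / suc x) ≤ M * suc e
    ∑-harmonic′ M = ≤-trans (∑-monoˡ (λ x → M / suc x) N≤2^e) (∑-harmonic M e)

    -- For fixed `r` at most p / (c r) values of `q` qualify; what remains is a harmonic sum over
    -- `r`.
    hyperbola : ∀ c .{{_ : NonZero c}} → ∑∑ (λ q r → 𝟙 (c * (q * r) ≤? p)) ≤ p / c * suc e
    hyperbola c = ≤-trans (∑-mono N λ {x} _ → row x) (∑-harmonic′ (p / c))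
      where
      row : ∀ x → ∑ N (λ y → 𝟙 (c * (suc y * suc x) ≤? p)) ≤ p / c / suc x
      row x = begin
        ∑ N (λ y → 𝟙 (c * (suc y * suc x) ≤? p))  ≤⟨ ∑-mono N (λ {y} _ → ≤-reflexive (cong (λ z → 𝟙 (z ≤? p)) (reorder c (suc y) (suc x)))) ⟩
        ∑ N (λ y → 𝟙 (c * suc x * suc y ≤? p))    ≤⟨ count-multiples N (c * suc x) p {{m*n≢0 c (suc x)}} ⟩
        (p / (c * suc x)) {{m*n≢0 c (suc x)}}     ≡⟨ sym (m/n/o≡m/[n*o] p c (suc x) {{_}} {{_}} {{m*n≢0 c (suc x)}}) ⟩
        p / c / suc x                             ∎
        where
        reorder : ∀ c q r → c * (q * r) ≡ c * r * q
        reorder = solve-∀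

    -- The indicators are summed over the pairs first: a threshold c admits at most (p / c) (e + 1)
    -- pairs, and a second harmonic sum, over the thresholds up to `T`, gives the factor `suc s`.
    -- The price `Z` is due only at threshold `T`.
    ∑∑-u : ∑∑ u ≤ p * suc s * suc e + p / T * suc e * Z
    ∑∑-u = begin
      ∑∑ u
        ≤⟨ ∑-mono N (λ {x} _ → ≤-reflexive (∑-+ N _ _)) ⟩
      ∑ N (λ x → ∑ N (λ y → ∑ T λ t → 𝟙 (suc t * (suc y * suc x) ≤? p)) + ∑ N (λ y → 𝟙 (T * (suc y * suc x) ≤? p) * Z))
        ≡⟨ ∑-+ N _ _ ⟩
      ∑∑ (λ q r → ∑ T λ t → 𝟙 (suc t * (q * r) ≤? p)) + ∑∑ (λ q r → 𝟙 (T * (q * r) ≤? p) * Z)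
        ≤⟨ +-mono-≤ first second ⟩
      p * suc s * suc e + p / T * suc e * Z ∎
      where
      first : ∑∑ (λ q r → ∑ T λ t → 𝟙 (suc t * (q * r) ≤? p)) ≤ p * suc s * suc e
      first = begin
        ∑∑ (λ q r → ∑ T λ t → 𝟙 (suc t * (q * r) ≤? p))
          ≤⟨ ∑-mono N (λ {x} _ → ≤-reflexive (∑-swap N T λ y t → 𝟙 (suc t * (suc y * suc x) ≤? p))) ⟩
        ∑ N (λ x → ∑ T λ t → ∑ N λ y → 𝟙 (suc t * (suc y * suc x) ≤? p))
          ≡⟨ ∑-swap N T _ ⟩
        ∑ T (λ t → ∑∑ λ q r → 𝟙 (suc t * (q * r) ≤? p))
          ≤⟨ ∑-mono T (λ {t} _ → hyperbola (suc t)) ⟩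
        ∑ T (λ t → p / suc t * suc e)
          ≡⟨ ∑-*ʳ T (λ t → p / suc t) (suc e) ⟩
        ∑ T (λ t → p / suc t) * suc e
          ≤⟨ *-monoˡ-≤ (suc e) (∑-harmonic p s) ⟩
        p * suc s * suc e ∎
      second : ∑∑ (λ q r → 𝟙 (T * (q * r) ≤? p) * Z) ≤ p / T * suc e * Z
      second = begin
        ∑∑ (λ q r → 𝟙 (T * (q * r) ≤? p) * Z)
          ≤⟨ ∑-mono N (λ {x} _ → ≤-reflexive (∑-*ʳ N (λ y → 𝟙 (T * (suc y * suc x) ≤? p)) Z)) ⟩
        ∑ N (λ x → ∑ N (λ y → 𝟙 (T * (suc y * suc x) ≤? p)) * Z)
          ≡⟨ ∑-*ʳ N _ Z ⟩
        ∑∑ (λ q r → 𝟙 (T * (q * r) ≤? p)) * Z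
          ≤⟨ *-monoˡ-≤ Z (hyperbola T) ⟩
        p / T * suc e * Z ∎

    module E (l : ℕ) = Euclid u Z u-spec l

    -- Exchanging the sums isolates each pair (q , r), which is hit at most twice as `m` varies.
    ∑∑v≤2∑∑u : ∑ N (λ l → ∑ N (E.v l)) ≤ ∑∑ u * 2
    ∑∑v≤2∑∑u = begin
      ∑ N (λ l → ∑ N λ x → ∑ N λ y → hit (suc y) (suc x) (suc l) * u (suc y) (suc x))
        ≡⟨ ∑-swap N N _ ⟩
      ∑ N (λ x → ∑ N λ l → ∑ N λ y → hit (suc y) (suc x) (suc l) * u (suc y) (suc x))
        ≤⟨ ∑-mono N (λ {x} _ → row x) ⟩
      ∑ N (λ x → ∑ N (λ y → u (suc y) (suc x)) * 2)
        ≡⟨ ∑-*ʳ N _ 2 ⟩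
      ∑∑ u * 2 ∎
      where
      row : ∀ x → ∑ N (λ l → ∑ N λ y → hit (suc y) (suc x) (suc l) * u (suc y) (suc x)) ≤ ∑ N (λ y → u (suc y) (suc x)) * 2
      row x = begin
        ∑ N (λ l → ∑ N λ y → hit (suc y) (suc x) (suc l) * u (suc y) (suc x))
          ≡⟨ ∑-swap N N _ ⟩
        ∑ N (λ y → ∑ N λ l → hit (suc y) (suc x) (suc l) * u (suc y) (suc x))
          ≤⟨ ∑-mono N (λ {y} y<N → ≤-trans (≤-reflexive (∑-*ʳ N (λ l → hit (suc y) (suc x) (suc l)) (u (suc y) (suc x))))
               (≤-trans (*-monoˡ-≤ (u (suc y) (suc x)) (∑-hit {suc y} (suc x) (s≤s z≤n) (s<s y<N)))
                 (≤-reflexive (*-comm 2 (u (suc y) (suc x)))))) ⟩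
        ∑ N (λ y → u (suc y) (suc x) * 2)
          ≡⟨ ∑-*ʳ N _ 2 ⟩
        ∑ N (λ y → u (suc y) (suc x)) * 2 ∎

    -- After multiplication by 4, small quotients contribute at most p (Z - 1), which explains the 8
    -- in `Z`, and large ones at most p Z, because T ≥ 8 (e + 1). The total is less than 2 p Z, and
    -- p ≤ 2 N.
    average : 1 ≤ N → ∑ N (λ l → ∑ N (E.v l)) < N * Z
    average 1≤N = *-cancelˡ-< 4 _ _ (begin-strict
      4 * ∑ N (λ l → ∑ N (E.v l))                                   ≤⟨ *-monoʳ-≤ 4 (≤-trans ∑∑v≤2∑∑u (*-monoˡ-≤ 2 ∑∑-u)) ⟩
      4 * ((p * suc s * suc e + p / T * suc e * Z) * 2)             ≡⟨ expand p (suc s) (suc e) (p / T) Z ⟩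
      p * (8 * suc e * suc s) + p / T * (8 * suc e) * Z             ≤⟨ +-monoʳ-≤ (p * (8 * suc e * suc s)) (*-monoˡ-≤ Z (≤-trans (*-monoʳ-≤ (p / T) 8+8e≤2^s) (m/n*n≤m p T))) ⟩
      p * (8 * suc e * suc s) + p * Z                               <⟨ +-monoˡ-< (p * Z) (*-monoʳ-< p (n<1+n (8 * suc e * suc s))) ⟩
      p * Z + p * Z                                                 ≡⟨ double p Z ⟩
      2 * p * Z                                                     ≤⟨ *-monoˡ-≤ Z (*-monoʳ-≤ 2 (+-monoˡ-≤ N 1≤N)) ⟩
      2 * (N + N) * Z                                               ≡⟨ double′ N Z ⟩
      4 * (N * Z)                                                   ∎)
      where
      expand : ∀ p s e d Z → 4 * ((p * s * e + d * e * Z) * 2) ≡ p * (8 * e * s) + d * (8 * e) * Z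
      expand = solve-∀
      double : ∀ p Z → p * Z + p * Z ≡ 2 * p * Z
      double = solve-∀
      double′ : ∀ N Z → 2 * (N + N) * Z ≡ 4 * (N * Z)
      double′ = solve-∀

    short-path : 1 ≤ N → ∃[ t ] ∃[ m ] SB t p m × t < Z
    short-path 1≤N =
      let l , l<N , small = pigeonhole N _ (average 1≤N)
          t , path , t<Z = E.shortPath l small l<N
      in t , suc l , path , t<Z

-- Dyadic size and padding

dyadic : ∀ n → 0 < n → ∃[ l ] 2 ^ l ≤ n × n < 2 ^ suc l
dyadic 1             _ = 0 , ≤-refl , ≤-refl
dyadic (suc (suc n)) _ with dyadic (suc n) (s≤s z≤n)
... | l , lo , hi with suc (suc n) <? 2 ^ suc l
...   | yes h = l , m≤n⇒m≤1+n lo , h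
...   | no  h = suc l , ≮⇒≥ h , ≤-<-trans hi (^-monoʳ-< 2 ≤-refl {suc l} ≤-refl)

^-cancel-≤ : ∀ {l j} → 2 ^ l ≤ 2 ^ j → l ≤ j
^-cancel-≤ h = ≮⇒≥ λ j<l → <⇒≱ (^-monoʳ-< 2 ≤-refl j<l) h

-- An element above everything leaves the number of linear extensions unchanged.
LE-pad : ∀ {n n′ k} → n ≤ n′ → LE n k → LE n′ k
LE-pad {n} {n′} {k} n≤n′ = subst (λ z → LE n k → LE z k) (m∸n+n≡m n≤n′) (go (n′ ∸ n))
  where
  go : ∀ d → LE n k → LE (d + n) k
  go zero    l = l
  go (suc d) l = realises⇒LE (addTop (go d l))

-- Factoring into primes

module _ (j s : ℕ) (j-s : 8 * (2 + j) ≤ 2 ^ s) where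
  open ≤-Reasoning

  -- The cost is linear in an exponent l with 2 ^ l ≤ p, with the same `s` for every prime, so that
  -- costs can be added over a factorisation.
  prime-path : ∀ {p} → Prime p → p ≤ 2 ^ j → ∃[ l ] ∃[ t ] ∃[ m ] 2 ^ l ≤ p × SB t p m × suc t ≤ 25 * l * suc s
  prime-path {zero} pr _ = contradiction (nonTrivial⇒n>1 0 {{prime⇒nonTrivial pr}}) λ ()
  prime-path {p@(suc N)} pr p≤2^j with nonTrivial⇒n>1 p {{prime⇒nonTrivial pr}} | dyadic p (s≤s z≤n)
  ... | 1<p | zero  , _  , hi = contradiction 1<p (<⇒≱ hi)
  ... | 1<p | l@(suc _) , lo , hi =
    -- Since p < 2 ^ (l + 1), the choice e = l + 1 is allowed, hence the factor 8 (l + 2) in `Z`. It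
    -- is at most 24 l because l ≥ 1, and one more l absorbs the leading 1.
    let t , m , path , t<Z = Modulus.Weights.short-path N pr (suc l) s (<⇒≤ (<-trans ≤-refl hi))
          (≤-trans (*-monoʳ-≤ 8 (+-monoʳ-≤ 2 (^-cancel-≤ {l} {j} (≤-trans lo p≤2^j)))) j-s) (s≤s⁻¹ 1<p)
    in l , t , m , lo , path , ≤-trans t<Z bound
    where
    bound : suc (8 * (2 + l) * suc s) ≤ 25 * l * suc s
    bound = begin
      1 + 8 * (2 + l) * suc s              ≤⟨ +-mono-≤ (*-mono-≤ {1} {l} (s≤s z≤n) (s≤s (z≤n {s})))
                                                (*-monoˡ-≤ (suc s) (*-monoʳ-≤ 8 (+-monoˡ-≤ l (*-monoʳ-≤ 2 {1} {l} (s≤s z≤n))))) ⟩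
      l * suc s + 8 * (2 * l + l) * suc s  ≡⟨ collect l (suc s) ⟩
      25 * l * suc s                       ∎
      where
      collect : ∀ l s → l * s + 8 * (2 * l + l) * s ≡ 25 * l * s
      collect = solve-∀

  -- Keeping 2 ^ l below the product bounds the sum of the exponents by log₂ of the product, however
  -- many primes occur.
  product-LE : ∀ {ps} → All Prime ps → product ps ≤ 2 ^ j →
    ∃[ l ] ∃[ n ] 2 ^ l ≤ product ps × n ≤ 25 * l * suc s × LE n (product ps)
  product-LE [] _ = 0 , 0 , ≤-refl , z≤n , 1∈LE[0]
  product-LE {p ∷ ps} (pr ∷ prs) h =
    let instance _ = >-nonZero (productOfPrimes≥1 prs)
        instance _ = >-nonZero (<⇒≤ (nonTrivial⇒n>1 p {{prime⇒nonTrivial pr}}))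
        l , t , m , lo , path , t≤ = prime-path pr (≤-trans (m≤m*n p (product ps)) h)
        l′ , n , lo′ , n≤ , le = product-LE prs (≤-trans (m≤n*m (product ps) p) h)
    in l + l′ , suc t + n ,
       subst (_≤ p * product ps) (sym (^-distribˡ-+-* 2 l l′)) (*-mono-≤ lo lo′) ,
       ≤-trans (+-mono-≤ t≤ n≤) (≤-reflexive (distrib l l′ (suc s))) ,
       subst (LE (suc t + n)) (*-comm (product ps) p) (realises⇒LE (SB⇒realises le path))
    where
    distrib : ∀ l l′ s → 25 * l * s + 25 * l′ * s ≡ 25 * (l + l′) * s
    distrib = solve-∀

  small-LE : ∀ {k n} → 0 < k → k ≤ 2 ^ j → 25 * j * suc s ≤ n → LE n k
  small-LE {k} 0<k k≤2^j h =
    let instance _ = >-nonZero 0<k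
        open PrimeFactorisation (factorise k)
        l , n , lo , n≤ , le = product-LE factorsPrime (subst (_≤ 2 ^ j) isFactorisation k≤2^j)
        l≤j = ^-cancel-≤ {l} {j} (≤-trans lo (subst (_≤ 2 ^ j) isFactorisation k≤2^j))
    in subst (LE _) (sym isFactorisation)
         (LE-pad (≤-trans n≤ (≤-trans (*-monoˡ-≤ (suc s) (*-monoʳ-≤ 25 l≤j)) h)) le)

-- Bounds for exp and log

module _ where
  open ℚ.≤-Reasoning
  open +-*-Solver using (solve; _:=_; _:+_; _:*_; _:-_; con)

  -- The slope of the partial sum is at most its value at the right endpoint, so a step of ½ gains
  -- at most half of that value, and at least half of it is present at `x`.
  expSum-double : ∀ m {x} → 0ℚ ℚ.≤ x → expSum (suc m) (x ℚ.+ ½) ℚ.≤ ι 2 ℚ.* expSum (suc m) x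
  expSum-double m {x} x≥0 = begin
    eB                                        ≡⟨ solve 2 (λ b e → b := con (ι 2) :* ((b :- e) :+ e :- con ½ :* b)) refl eB e ⟩
    ι 2 ℚ.* ((eB ℚ.- e) ℚ.+ e ℚ.- ½ ℚ.* eB)   ≤⟨ *-monoˡ (ι 2) (ι≥0 2) (ℚ.+-monoˡ-≤ (ℚ.- (½ ℚ.* eB)) (ℚ.+-monoˡ-≤ e increment)) ⟩
    ι 2 ℚ.* (½ ℚ.* eB ℚ.+ e ℚ.- ½ ℚ.* eB)     ≡⟨ solve 2 (λ h e → con (ι 2) :* (h :+ e :- h) := con (ι 2) :* e) refl (½ ℚ.* eB) e ⟩
    ι 2 ℚ.* e                                 ∎
    where
    B e eB : ℚ
    B = x ℚ.+ ½
    e = expSum (suc m) x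
    eB = expSum (suc m) B
    B≥0 : 0ℚ ℚ.≤ B
    B≥0 = +-≥0 x≥0 ½≥0
    x≤B : x ℚ.≤ B
    x≤B = ≤+ x ½≥0
    ∣B-x∣ : ℚ.∣ B ℚ.- x ∣ ≡ ½
    ∣B-x∣ = cong ℚ.∣_∣ (solve 1 (λ x → x :+ con ½ :- x := con ½) refl x)
    increment : eB ℚ.- e ℚ.≤ ½ ℚ.* eB
    increment = begin
      eB ℚ.- e                             ≤⟨ p≤∣p∣ (eB ℚ.- e) ⟩
      ℚ.∣ eB ℚ.- e ∣                       ≤⟨ OnBall.expSum-lip B B≥0 m (ℚ.≤-reflexive (ℚ.0≤p⇒∣p∣≡p B≥0))
                                               (subst (ℚ._≤ B) (sym (ℚ.0≤p⇒∣p∣≡p x≥0)) x≤B) ⟩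
      ℚ.∣ B ℚ.- x ∣ ℚ.* expSum m B         ≡⟨ cong (ℚ._* expSum m B) ∣B-x∣ ⟩
      ½ ℚ.* expSum m B                     ≤⟨ *-monoˡ ½ ½≥0 (≤+ (expSum m B) (term≥0 (suc m) B≥0)) ⟩
      ½ ℚ.* eB                             ∎

  expSum≤2^ : ∀ m j → expSum m (ι j ℚ.* ½) ℚ.≤ ι (2 ^ j)
  expSum≤2^ zero    j = ι-mono {1} (m^n>0 2 j)
  expSum≤2^ (suc m) zero = ℚ.≤-reflexive (trans (cong (expSum (suc m)) (ℚ.*-zeroˡ ½)) (expSum-0 (suc m)))
  expSum≤2^ (suc m) (suc j) = begin
    expSum (suc m) (ι (suc j) ℚ.* ½)           ≡⟨ cong (expSum (suc m)) (trans (cong (ℚ._* ½) (ι-+ 1 j))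
                                                    (solve 1 (λ a → (con 1ℚ :+ a) :* con ½ := a :* con ½ :+ con ½) refl (ι j))) ⟩
    expSum (suc m) (ι j ℚ.* ½ ℚ.+ ½)           ≤⟨ expSum-double m (*-≥0 (ι≥0 j) ½≥0) ⟩
    ι 2 ℚ.* expSum (suc m) (ι j ℚ.* ½)         ≤⟨ *-monoˡ (ι 2) (ι≥0 2) (expSum≤2^ (suc m) j) ⟩
    ι 2 ℚ.* ι (2 ^ j)                          ≡⟨ sym (ι-* 2 (2 ^ j)) ⟩
    ι (2 ^ suc j)                              ∎

  -- The partial sums at σ / 2 are at most 2 ^ σ ≤ n, and σ / 2 is a grid point for every `m`; σ ≤ n
  -- keeps it inside the search range.
  logSeq-lower : ∀ {n} σ m → σ ≤ n → 2 ^ σ ≤ n → ι σ ℚ.* ½ ℚ.≤ logSeq n m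
  logSeq-lower {n} σ m σ≤n 2^σ≤n = subst (ℚ._≤ logSeq n m) grid≡
    (grid-mono m (greatest-max (below? n m) (top n m) (*-monoˡ-≤ (suc m) (≤-trans σ≤n (m≤m*n n 2)))
      (subst (λ z → expSum m z ℚ.≤ ι n) (sym grid≡) (ℚ.≤-trans (expSum≤2^ m σ) (ι-mono 2^σ≤n)))))
    where
    grid≡ : grid m (σ * suc m) ≡ ι σ ℚ.* ½
    grid≡ = begin-equality
      ι (σ * suc m) ℚ.* (½ ℚ.* inv m)        ≡⟨ cong (ℚ._* (½ ℚ.* inv m)) (ι-* σ (suc m)) ⟩
      ι σ ℚ.* ι (suc m) ℚ.* (½ ℚ.* inv m)    ≡⟨ solve 4 (λ a b h v → a :* b :* (h :* v) := a :* h :* (b :* v)) refl (ι σ) (ι (suc m)) ½ (inv m) ⟩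
      ι σ ℚ.* ½ ℚ.* (ι (suc m) ℚ.* inv m)    ≡⟨ cong (ι σ ℚ.* ½ ℚ.*_) (ι*inv m) ⟩
      ι σ ℚ.* ½ ℚ.* 1ℚ                       ≡⟨ ℚ.*-identityʳ (ι σ ℚ.* ½) ⟩
      ι σ ℚ.* ½                              ∎

  -- Distinct integers differ by at least 1, so an error of ½ is harmless.
  ι-cancel-½ : ∀ {a b} → ι a ℚ.≤ ι b ℚ.+ ½ → a ≤ b
  ι-cancel-½ {a} {b} h = ≮⇒≥ λ b<a → ℚ.<-irrefl {ι b} refl (begin-strict
    ι b                  ≡⟨ solve 1 (λ b → b := b :+ con 0ℚ) refl (ι b) ⟩
    ι b ℚ.+ 0ℚ           <⟨ ℚ.+-monoʳ-< (ι b) ½>0 ⟩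
    ι b ℚ.+ ½            ≡⟨ solve 1 (λ b → b :+ con ½ := con 1ℚ :+ b :- con ½) refl (ι b) ⟩
    1ℚ ℚ.+ ι b ℚ.- ½     ≡⟨ cong (ℚ._- ½) (sym (ι-+ 1 b)) ⟩
    ι (suc b) ℚ.- ½      ≤⟨ ℚ.+-monoˡ-≤ (ℚ.- ½) (ι-mono b<a) ⟩
    ι a ℚ.- ½            ≤⟨ ℚ.+-monoˡ-≤ (ℚ.- ½) h ⟩
    ι b ℚ.+ ½ ℚ.- ½      ≡⟨ solve 1 (λ b → b :+ con ½ :- con ½ := b) refl (ι b) ⟩
    ι b                  ∎)

  -- The value 1 / 400: n ≤ 100 σ j and log n ≥ σ / 2 give n / log n ≤ 200 j, so the exponent is at
  -- most j / 2.
  c₀ : ℚ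
  c₀ = inv 399

  exponent-bound : ∀ {n σ j l} → 0 < σ → n ≤ 100 * σ * j → ι σ ℚ.* ½ ℚ.≤ l → c₀ ℚ.* (ι n ℚ.* recip l) ℚ.≤ ι j ℚ.* ½
  exponent-bound {n} {σ} {j} {l} 0<σ n≤ h≤l = begin
    c₀ ℚ.* (ι n ℚ.* recip l)
      ≤⟨ *-monoˡ c₀ (inv≥0 399) (*-mono (ι≥0 (100 * σ * j)) (recip≥0 (ℚ.<-≤-trans h>0 h≤l)) (ι-mono n≤) (recip-anti h>0 h≤l)) ⟩
    c₀ ℚ.* (ι (100 * σ * j) ℚ.* recip h)
      ≡⟨ cong (λ z → c₀ ℚ.* (z ℚ.* recip h)) (trans (ι-* (100 * σ) j) (cong (ℚ._* ι j) (ι-* 100 σ))) ⟩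
    c₀ ℚ.* (ι 100 ℚ.* ι σ ℚ.* ι j ℚ.* recip h)
      ≡⟨ solve 3 (λ s j r → con c₀ :* (con (ι 100) :* s :* j :* r) := con ½ :* j :* (r :* (s :* con ½))) refl (ι σ) (ι j) (recip h) ⟩
    ½ ℚ.* ι j ℚ.* (recip h ℚ.* h)
      ≡⟨ cong (½ ℚ.* ι j ℚ.*_) (recip-inverse⁺ h>0) ⟩
    ½ ℚ.* ι j ℚ.* 1ℚ
      ≡⟨ solve 1 (λ j → con ½ :* j :* con 1ℚ := j :* con ½) refl (ι j) ⟩
    ι j ℚ.* ½ ∎
    where
    h : ℚ
    h = ι σ ℚ.* ½
    h>0 : 0ℚ ℚ.< h
    h>0 = *->0 (ℚ.<-≤-trans (ℚ.positive⁻¹ 1ℚ) (ι-mono {1} 0<σ)) ½>0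

  exp-bound : ∀ {n σ j k} (1<n : 1 < n) → 0 < σ → σ ≤ n → 2 ^ σ ≤ n → n ≤ 100 * σ * j →
    fromℕ k ≤ᴿ exp (fromℚ c₀ *ᴿ (fromℕ n /ᴿ log n [ log-pos 1<n ])) → k ≤ 2 ^ j
  exp-bound {n@(suc _)} {σ} {j} {k} 1<n 0<σ σ≤n 2^σ≤n n≤ hyp =
    -- As `k` and 2 ^ j are integers, a single approximation with error ½ decides the comparison.
    let M , h = hyp ½>0
        h≤l = logSeq-lower {n} σ M σ≤n 2^σ≤n
        l>0 = ℚ.<-≤-trans (*->0 (ℚ.<-≤-trans (ℚ.positive⁻¹ 1ℚ) (ι-mono {1} 0<σ)) ½>0) h≤l
    in ι-cancel-½ (ℚ.≤-trans (h M ≤-refl) (ℚ.+-monoˡ-≤ ½ (ℚ.≤-trans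
         (expSum-mono M (*-≥0 (inv≥0 399) (*-≥0 (ι≥0 n) (recip≥0 l>0))) (exponent-bound 0<σ n≤ h≤l))
         (expSum≤2^ M j))))

-- Choice of parameters

100n≤2^n : ∀ d → 100 * (10 + d) ≤ 2 ^ (10 + d)
-- The inequality 1000 ≤ 1024 is the source of the threshold 2 ^ 10.
100n≤2^n zero    = m≤m+n 1000 24
100n≤2^n (suc d) = begin
  100 * (11 + d)                    ≤⟨ m≤m+n _ (900 + 100 * d) ⟩
  100 * (11 + d) + (900 + 100 * d)  ≡⟨ double d ⟩
  2 * (100 * (10 + d))              ≤⟨ *-monoʳ-≤ 2 (100n≤2^n d) ⟩
  2 ^ (11 + d)                      ∎
  where
  open ≤-Reasoning
  double : ∀ d → 100 * (11 + d) + (900 + 100 * d) ≡ 2 * (100 * (10 + d))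
  double = solve-∀

module Parameters (n : ℕ) (1024≤n : 2 ^ 10 ≤ n) where
  open ≤-Reasoning

  σ-spec : ∃[ l ] 2 ^ l ≤ n × n < 2 ^ suc l
  σ-spec = dyadic n (≤-trans (s≤s z≤n) 1024≤n)

  σ : ℕ
  σ = proj₁ σ-spec

  2^σ≤n : 2 ^ σ ≤ n
  2^σ≤n = proj₁ (proj₂ σ-spec)

  n<2^1+σ : n < 2 ^ suc σ
  n<2^1+σ = proj₂ (proj₂ σ-spec)

  10≤σ : 10 ≤ σ
  10≤σ = s≤s⁻¹ (≮⇒≥ λ h → <⇒≱ n<2^1+σ (≤-trans (^-monoʳ-≤ 2 (s≤s⁻¹ h)) 1024≤n))

  100σ≤n : 100 * σ ≤ n
  100σ≤n = ≤-trans (subst (λ z → 100 * z ≤ 2 ^ z) (m+[n∸m]≡n 10≤σ) (100n≤2^n (σ ∸ 10))) 2^σ≤n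

  instance
    100σ≢0 : NonZero (100 * σ)
    100σ≢0 = >-nonZero (*-mono-≤ {1} {100} (s≤s z≤n) (≤-trans (s≤s z≤n) 10≤σ))

  -- Rounding up in `j` secures n ≤ 100 σ j, from which k ≤ 2 ^ j follows; s = σ + 4 is chosen for 8
  -- (2 + j) ≤ 24 j ≤ 8 n < 2 ^ s.
  j s : ℕ
  j = suc (n / (100 * σ))
  s = 4 + σ

  n≤100σj : n ≤ 100 * σ * j
  n≤100σj = begin
    n                                            ≡⟨ m≡m%n+[m/n]*n n (100 * σ) ⟩
    n % (100 * σ) + n / (100 * σ) * (100 * σ)    ≤⟨ +-monoˡ-≤ _ (<⇒≤ (m%n<n n (100 * σ))) ⟩
    j * (100 * σ)                                ≡⟨ *-comm j (100 * σ) ⟩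
    100 * σ * j                                  ∎

  -- Rounding up at most doubles n / (100 σ), because 100 σ ≤ n.
  50σj≤n : 50 * σ * j ≤ n
  50σj≤n = *-cancelˡ-≤ 2 (begin
    2 * (50 * σ * j)                          ≡⟨ rearrange σ j ⟩
    j * (100 * σ)                             ≤⟨ +-mono-≤ 100σ≤n (m/n*n≤m n (100 * σ)) ⟩
    n + n                                     ≡⟨ cong (n +_) (sym (+-identityʳ n)) ⟩
    2 * n                                     ∎)
    where
    rearrange : ∀ σ j → 2 * (50 * σ * j) ≡ j * (100 * σ)
    rearrange = solve-∀

  size : 25 * j * suc s ≤ n
  size = ≤-trans (begin
    25 * j * (5 + σ)  ≤⟨ *-monoʳ-≤ (25 * j) (+-monoˡ-≤ σ (≤-trans (m≤n+m 5 5) 10≤σ)) ⟩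
    25 * j * (σ + σ)  ≡⟨ rearrange σ j ⟩
    50 * σ * j        ∎) 50σj≤n
    where
    rearrange : ∀ σ j → 25 * j * (σ + σ) ≡ 50 * σ * j
    rearrange = solve-∀

  s-large : 8 * (2 + j) ≤ 2 ^ s
  s-large = begin
    8 * (2 + j)          ≤⟨ *-monoʳ-≤ 8 (+-monoˡ-≤ j (*-monoʳ-≤ 2 {1} {j} (s≤s z≤n))) ⟩
    8 * (2 * j + j)      ≡⟨ cong (8 *_) (rearrange j) ⟩
    8 * (3 * j)          ≤⟨ *-monoʳ-≤ 8 (*-monoˡ-≤ j (*-mono-≤ {3} {50} {1} {σ} (m≤m+n 3 47) (≤-trans (s≤s z≤n) 10≤σ))) ⟩
    8 * (50 * σ * j)     ≤⟨ *-monoʳ-≤ 8 (≤-trans 50σj≤n (<⇒≤ n<2^1+σ)) ⟩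
    8 * 2 ^ suc σ        ≡⟨ sym (^-distribˡ-+-* 2 3 (suc σ)) ⟩
    2 ^ (3 + suc σ)      ≡⟨ cong (2 ^_) (+-suc 3 σ) ⟩
    2 ^ s                ∎
    where
    rearrange : ∀ j → 2 * j + j ≡ 3 * j
    rearrange = solve-∀

theorem1p1 : ∃[ c ] 0ᴿ <ᴿ c × (∃[ n₀ ] ∀ (n : ℕ) (1<n : 1 < n) → n₀ ≤ n →
    ∀ (k : ℕ) → 0 < k → fromℕ k ≤ᴿ exp (c *ᴿ (fromℕ n /ᴿ log n [ log-pos 1<n ])) → k ∈ LE n)
theorem1p1 = fromℚ c₀ , (c₀ , inv>0 399 , 0 , λ _ _ → ℚ.≤-reflexive (ℚ.+-identityˡ c₀)) , 2 ^ 10 ,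
  λ n 1<n n₀≤n k 0<k hyp →
    small n n₀≤n 0<k (bound n n₀≤n 1<n hyp)
  where
  small : ∀ n (h : 2 ^ 10 ≤ n) {k} → 0 < k → k ≤ 2 ^ Parameters.j n h → k ∈ LE n
  small n h 0<k k≤ = small-LE j s s-large 0<k k≤ size
    where open Parameters n h
  bound : ∀ n (h : 2 ^ 10 ≤ n) (1<n : 1 < n) {k} →
    fromℕ k ≤ᴿ exp (fromℚ c₀ *ᴿ (fromℕ n /ᴿ log n [ log-pos 1<n ])) → k ≤ 2 ^ Parameters.j n h
  bound n h 1<n = exp-bound 1<n (≤-trans (s≤s z≤n) 10≤σ) (≤-trans (m≤n*m σ 100) 100σ≤n) 2^σ≤n n≤100σj
    where open Parameters n h
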